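{- Let $(\alpha,\beta)\in\Delta_K$, $(\alpha_n,\beta_n)=T^n(\alpha,\beta)$, $\varepsilon_n=\varepsilon(\alpha_n,\beta_n)$, and $n\ge0$. Then the dual substitution $\Theta_{\varepsilon_n}$ satisfies: (1) if $(\bar{\bar x},i^*)\in\mathscr S(\bar{\bar\nu}(\alpha_{n+1},\beta_{n+1}))$, then every unit square occurring in $\Theta_{\varepsilon_n}(\bar{\bar x},i^*)$ belongs to $\mathscr S(\bar{\bar\nu}(\alpha_n,\beta_n))$, so $\Theta_{\varepsilon_n}(\bar{\bar x},i^*)\in\mathcal G(\bar{\bar\nu}(\alpha_n,\beta_n))$; (2) two distinct unit squares of $\mathscr S(\bar{\bar\nu}(\alpha_{n+1},\beta_{n+1}))$ are sent to images having no unit square in common (i.e. disjoint except for their boundaries); (3) for every $(\bar{\bar z},k^*)\in\mathscr S(\bar{\bar\nu}(\alpha_n,\beta_n))$ there exists $(\bar{\bar x},i^*)\in\mathscr S(\bar{\bar\nu}(\alpha_{n+1},\beta_{n+1}))$ such that $\Theta_{\varepsilon_n}(\bar{\bar x},i^*)\succ(\bar{\bar z},k^*)$, i.e. $(\bar{\bar z},k^*)$ is one of the unit squares of $\Theta_{\varepsilon_n}(\bar{\bar x},i^*)$.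
   Context: Let $K\subset\mathbb{R}$ be a real cubic number field, $N=N_{K/\mathbb{Q}}$ its norm. Fix $r=p/q$ with $p,q$ positive coprime integers and $3\nmid p$. Let $\Delta_K=\{(\alpha,\beta)\in K^2:\ 1,\alpha,\beta \text{ linearly independent over }\mathbb{Q},\ \alpha,\beta>0,\ \alpha+\beta<1\}$ and $Ind=\{(i,j): i,j\in\{0,1,2\},\ i\neq j\}$. Let $\Delta=\{(x,y)\in\mathbb{R}^2: x,y\ge 0,\ x+y\le 1\}$ and $\triangle(1,2)=\{(x,y)\in\Delta: x\ge y\}$, $\triangle(2,1)=\{x\le y\}$, $\triangle(0,1)=\{2x+y-1\le 0\}$, $\triangle(1,0)=\{2x+y-1\ge 0\}$, $\triangle(0,2)=\{x+2y-1\le0\}$, $\triangle(2,0)=\{x+2y-1\ge 0\}$ (all subsets of $\Delta$). Maps $T_{(i,j)}:\triangle(i,j)\to\Delta$: $T_{(1,2)}(x,y)=(\frac{x-y}{1-y},\frac{y}{1-y})$, $T_{(2,1)}(x,y)=(\frac{x}{1-x},\frac{y-x}{1-x})$, $T_{(0,1)}(x,y)=(\frac{x}{1-x},\frac{y}{1-x})$, $T_{(1,0)}(x,y)=(\frac{2x+y-1}{x+y},\frac{y}{x+y})$, $T_{(0,2)}(x,y)=(\frac{x}{1-y},\frac{y}{1-y})$, $T_{(2,0)}(x,y)=(\frac{x}{x+y},\frac{x+2y-1}{x+y})$. For $(\alpha,\beta)\in\Delta_K$ put $\gamma=1-\alpha-\beta$ and $v_{\{1,2\}}=\frac{\alpha^r\beta^r}{|N(\alpha)N(\beta)|}$,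 $v_{\{0,1\}}=\frac{\alpha^r\gamma^r}{|N(\alpha)N(\gamma)|}$, $v_{\{0,2\}}=\frac{\beta^r\gamma^r}{|N(\beta)N(\gamma)|}$; the maximum is attained at a unique pair $\{i_0,j_0\}$. $\varepsilon(\alpha,\beta)$ is the ordered pair $(i,j)\in Ind$ with $\{i,j\}=\{i_0,j_0\}$ and $(\alpha,\beta)\in\triangle(i,j)$, and $T(\alpha,\beta)=T_{\varepsilon(\alpha,\beta)}(\alpha,\beta)$ (a map $\Delta_K\to\Delta_K$). For $(i,j)\in Ind$, $M_{(i,j)}=(m_{k\ell})_{0\le k,\ell\le2}$ with $m_{k\ell}=1$ if $k=\ell$ or $(k,\ell)=(i,j)$, and $0$ otherwise; $L_{(i,j)}:=M_{(j,i)}$. For $(\alpha,\beta)\in\Delta_K$, $\bar{\bar\nu}(\alpha,\beta)={}^t(1-\alpha-\beta,\alpha,\beta)$. Let $\bar{\bar e}_0,\bar{\bar e}_1,\bar{\bar e}_2$ be the standard basis of $\mathbb{R}^3$. A unit square $(\bar{\bar x},i^*)$ ($\bar{\bar x}\in\mathbb{Z}^3$, $i\in\{0,1,2\}$) is the set $\{\bar{\bar x}+t\bar{\bar e}_j+u\bar{\bar e}_k: t,u\in[0,1]\}$ with $\{i,j,k\}=\{0,1,2\}$. For $\bar{\bar a}\in\mathbb{R}^3_{>0}$ with $\mathbb{Q}$-linearly independent coordinates, the stepped surface is $\mathscr S(\bar{\bar a})=\{(\bar{\bar x},i^*): \bar{\bar x}\in\mathbb{Z}^3, i\in\{0,1,2\},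 \langle\bar{\bar x},\bar{\bar a}\rangle>0,\ \langle\bar{\bar x}-\bar{\bar e}_i,\bar{\bar a}\rangle\le0\}$, and $\mathcal G(\bar{\bar a})$ is the free $\mathbb{Z}$-module of finite formal sums of elements of $\mathscr S(\bar{\bar a})$. A sum with all coefficients $1$ (a patch) is identified with its finite set of squares; for patches $\gamma,\delta$, $\gamma\prec\delta$ (equivalently $\delta\succ\gamma$) means the set of squares of $\gamma$ is contained in that of $\delta$. For $(i,j)\in Ind$ the dual substitution $\Theta_{(i,j)}$ is defined on unit squares by $\Theta_{(i,j)}(\bar{\bar x},j^*)=(L_{(i,j)}^{ -1}(\bar{\bar x}+\bar{\bar e}_i),i^*)+(L_{(i,j)}^{ -1}\bar{\bar x},j^*)$ and $\Theta_{(i,j)}(\bar{\bar x},k^*)=(L_{(i,j)}^{ -1}\bar{\bar x},k^*)$ for $k\neq j$, and extended additively to formal sums. -}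

module Defs where

open import Level using (0ℓ)
open import Algebra.Bundles using (CommutativeRing)
open import Algebra.Solver.Ring.AlmostCommutativeRing using (fromCommutativeRing; _-Raw-AlmostCommutative⟶_)
import Algebra.Properties.Ring
import Algebra.Properties.AbelianGroup
import Algebra.Properties.Semiring.Exp
import Algebra.Properties.Semiring.Mult.TCOptimised
import Algebra.Solver.Ring
open import Data.Bool.Base using (if_then_else_)
open import Data.Empty using (⊥-elim)
open import Data.Fin.Base using (Fin)
open import Data.Fin.Patterns using (0F; 1F; 2F)
open import Data.Fin.Properties as Fin using (all?)
open import Data.Integer.Base as ℤ using (ℤ; +_; -[1+_]; 0ℤ; 1ℤ; -1ℤ; _⊖_)
import Data.Integer.Properties as ℤ
open import Data.List.Base using (List; []; _∷_; map; concatMap)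
open import Data.List.Relation.Unary.All using (All)
open import Data.Maybe.Base using (Maybe; just; nothing)
open import Data.Nat.Base as ℕ using (ℕ; zero; suc; NonZero)
open import Data.Nat.GeneralisedArithmetic using (fold)
open import Data.Product.Base using (Σ; Σ-syntax; ∃; _×_; _,_; proj₁; proj₂)
import Data.Product.Properties as Product
open import Data.Rational.Base as ℚ using (ℚ; 0ℚ; toℚᵘ)
import Data.Rational.Properties as ℚ
open import Data.Rational.Unnormalised.Base as ℚᵘ using (ℚᵘ; *≡*)
import Data.Rational.Unnormalised.Properties as ℚᵘ
open import Data.Sum.Base using (_⊎_; inj₁; inj₂)
open import Data.Vec.Base using (Vec; []; _∷_; lookup; tabulate; zipWith)
import Data.Vec.Properties as Vec
open import Relation.Binary.Core using (Rel)
open import Relation.Binary.Definitions using (DecidableEquality)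
open import Relation.Binary.PropositionalEquality.Core as ≡ using (_≡_; _≢_)
open import Relation.Binary.Structures using (IsDecTotalOrder)
import Relation.Binary.Construct.NonStrictToStrict as Strict
import Relation.Binary.Reasoning.Setoid as SetoidReasoning
open import Relation.Nullary.Decidable using (yes; no; ⌊_⌋; ¬?; _×-dec_; _⊎-dec_; _→-dec_; from-yes)
open import Relation.Nullary.Negation using (¬_; contradiction)

-- The classical axioms of a Dedekind-complete ordered field, which
-- determine ℝ up to a unique isomorphism.  The order is assumed total and
-- decidable, as it is classically.

record RealNumbers : Set₁ where
  infix 4 _≤_
  field
    commutativeRing : CommutativeRing 0ℓ 0ℓ
  open CommutativeRing commutativeRing public
  field
    _≤_             : Rel Carrier 0ℓ
    isDecTotalOrder : IsDecTotalOrder _≈_ _≤_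
    1≉0             : ¬ 1# ≈ 0#
    inverse         : ∀ x → ¬ x ≈ 0# → ∃ λ y → x * y ≈ 1#
    +-monoˡ-≤       : ∀ z {x y} → x ≤ y → x + z ≤ y + z
    *-nonneg        : ∀ {x y} → 0# ≤ x → 0# ≤ y → 0# ≤ x * y
    supremum        : (P : Carrier → Set) → ∃ P → (∃ λ b → ∀ x → P x → x ≤ b) →
                      ∃ λ s → (∀ x → P x → x ≤ s) ×
                              (∀ b → (∀ x → P x → x ≤ b) → s ≤ b)

  open Strict _≈_ _≤_ public using (_<_)
  open IsDecTotalOrder isDecTotalOrder public
    using (_≟_; _≤?_; antisym; total; ≤-respˡ-≈; ≤-respʳ-≈)
    renaming (refl to ≤-refl; reflexive to ≤-reflexive; trans to ≤-trans)
  open Algebra.Properties.Semiring.Exp semiring public using (_^_)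
  open Algebra.Properties.Semiring.Mult.TCOptimised semiring using () renaming (_×_ to _×ₙ_)

  infix  8 _⁻¹
  infixl 7 _/_

  -- Totalised by 0 ⁻¹ = 0.
  _⁻¹ : Carrier → Carrier
  x ⁻¹ with x ≟ 0#
  ... | yes _   = 0#
  ... | no  x≉0 = proj₁ (inverse x x≉0)

  _/_ : Carrier → Carrier → Carrier
  x / y = x * y ⁻¹

  fromℕ : ℕ → Carrier
  fromℕ n = n ×ₙ 1#

  fromℤ : ℤ → Carrier
  fromℤ (+ n)    = fromℕ n
  fromℤ -[1+ n ] = - fromℕ (suc n)

  fromℚᵘ : ℚᵘ → Carrier
  fromℚᵘ u = fromℤ (ℚᵘ.↥ u) / fromℤ (ℚᵘ.↧ u)

  fromℚ : ℚ → Carrier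
  fromℚ a = fromℚᵘ (toℚᵘ a)

  LinIndep : Carrier → Carrier → Carrier → Set
  LinIndep x y z = ∀ (a b c : ℚ) →
    fromℚ a * x + fromℚ b * y + fromℚ c * z ≈ 0# → a ≡ 0ℚ × b ≡ 0ℚ × c ≡ 0ℚ

module RealProperties (𝓡 : RealNumbers) where
  open RealNumbers 𝓡
  open Algebra.Properties.Ring ring using (-0#≈0#; -‿distribˡ-*; -‿distribʳ-*; -‿involutive)
  open Algebra.Properties.AbelianGroup +-abelianGroup using (⁻¹-∙-comm)
  open Algebra.Properties.Semiring.Mult.TCOptimised semiring using (1+×; ×-homo-+; ×1-homo-*)
  open SetoidReasoning setoid

  fromℤ-⊖ : ∀ m n → fromℤ (m ⊖ n) ≈ fromℕ m + - fromℕ n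
  fromℤ-⊖ m zero = sym (trans (+-congˡ -0#≈0#) (+-identityʳ _))
  fromℤ-⊖ zero (suc n) = sym (+-identityˡ _)
  fromℤ-⊖ (suc m) (suc n) = begin
    fromℤ (suc m ⊖ suc n)                     ≡⟨ ≡.cong fromℤ (ℤ.[1+m]⊖[1+n]≡m⊖n m n) ⟩
    fromℤ (m ⊖ n)                             ≈⟨ fromℤ-⊖ m n ⟩
    fromℕ m + - fromℕ n                       ≈⟨ +-identityˡ _ ⟨
    0# + (fromℕ m + - fromℕ n)                ≈⟨ +-congʳ (-‿inverseʳ 1#) ⟨
    (1# + - 1#) + (fromℕ m + - fromℕ n)       ≈⟨ +-assoc _ _ _ ⟩
    1# + (- 1# + (fromℕ m + - fromℕ n))       ≈⟨ +-congˡ (+-assoc _ _ _) ⟨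
    1# + ((- 1# + fromℕ m) + - fromℕ n)       ≈⟨ +-congˡ (+-congʳ (+-comm _ _)) ⟩
    1# + ((fromℕ m + - 1#) + - fromℕ n)       ≈⟨ +-congˡ (+-assoc _ _ _) ⟩
    1# + (fromℕ m + (- 1# + - fromℕ n))       ≈⟨ +-assoc _ _ _ ⟨
    (1# + fromℕ m) + (- 1# + - fromℕ n)       ≈⟨ +-congˡ (⁻¹-∙-comm _ _) ⟩
    (1# + fromℕ m) + - (1# + fromℕ n)         ≈⟨ +-cong (1+× m 1#) (-‿cong (1+× n 1#)) ⟨
    fromℕ (suc m) + - fromℕ (suc n)           ∎

  fromℤ-neg : ∀ i → fromℤ (ℤ.- i) ≈ - fromℤ i
  fromℤ-neg (+ zero)  = sym -0#≈0#
  fromℤ-neg (+ suc n) = refl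
  fromℤ-neg -[1+ n ]  = sym (-‿involutive _)

  fromℤ-+ : ∀ i j → fromℤ (i ℤ.+ j) ≈ fromℤ i + fromℤ j
  fromℤ-+ (+ m)    (+ n)    = ×-homo-+ 1# m n
  fromℤ-+ (+ m)    -[1+ n ] = fromℤ-⊖ m (suc n)
  fromℤ-+ -[1+ m ] (+ n)    = trans (fromℤ-⊖ n (suc m)) (+-comm _ _)
  fromℤ-+ -[1+ m ] -[1+ n ] = begin
    - fromℕ (suc (suc (m ℕ.+ n)))        ≡⟨ ≡.cong (λ k → - fromℕ k) (ℕ-lemma m n) ⟩
    - fromℕ (suc m ℕ.+ suc n)            ≈⟨ -‿cong (×-homo-+ 1# (suc m) (suc n)) ⟩
    - (fromℕ (suc m) + fromℕ (suc n))    ≈⟨ ⁻¹-∙-comm _ _ ⟨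
    - fromℕ (suc m) + - fromℕ (suc n)    ∎
    where
    ℕ-lemma : ∀ m n → suc (suc (m ℕ.+ n)) ≡ suc m ℕ.+ suc n
    ℕ-lemma zero    n = ≡.refl
    ℕ-lemma (suc m) n = ≡.cong suc (ℕ-lemma m n)

  fromℤ-*-pos : ∀ m n → fromℤ (+ m ℤ.* + n) ≈ fromℕ m * fromℕ n
  fromℤ-*-pos m n = trans (reflexive (≡.cong fromℤ (≡.sym (ℤ.pos-* m n)))) (×1-homo-* m n)

  fromℤ-*-posˡ : ∀ m j → fromℤ (+ m ℤ.* j) ≈ fromℕ m * fromℤ j
  fromℤ-*-posˡ m (+ n)    = fromℤ-*-pos m n
  fromℤ-*-posˡ m -[1+ n ] = begin
    fromℤ (+ m ℤ.* ℤ.- (+ suc n))     ≡⟨ ≡.cong fromℤ (ℤ.neg-distribʳ-* (+ m) (+ suc n)) ⟨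
    fromℤ (ℤ.- (+ m ℤ.* + suc n))     ≈⟨ fromℤ-neg (+ m ℤ.* + suc n) ⟩
    - fromℤ (+ m ℤ.* + suc n)         ≈⟨ -‿cong (fromℤ-*-pos m (suc n)) ⟩
    - (fromℕ m * fromℕ (suc n))       ≈⟨ -‿distribʳ-* _ _ ⟩
    fromℕ m * - fromℕ (suc n)         ∎

  fromℤ-* : ∀ i j → fromℤ (i ℤ.* j) ≈ fromℤ i * fromℤ j
  fromℤ-* (+ m)    j = fromℤ-*-posˡ m j
  fromℤ-* -[1+ m ] j = begin
    fromℤ (ℤ.- (+ suc m) ℤ.* j)       ≡⟨ ≡.cong fromℤ (ℤ.neg-distribˡ-* (+ suc m) j) ⟨
    fromℤ (ℤ.- (+ suc m ℤ.* j))       ≈⟨ fromℤ-neg (+ suc m ℤ.* j) ⟩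
    - fromℤ (+ suc m ℤ.* j)           ≈⟨ -‿cong (fromℤ-*-posˡ (suc m) j) ⟩
    - (fromℕ (suc m) * fromℤ j)       ≈⟨ -‿distribˡ-* _ _ ⟩
    - fromℕ (suc m) * fromℤ j         ∎

  fromℤ-morphism : ℤ.+-*-rawRing -Raw-AlmostCommutative⟶ fromCommutativeRing commutativeRing
  fromℤ-morphism = record
    { ⟦_⟧    = fromℤ
    ; +-homo = fromℤ-+
    ; *-homo = fromℤ-*
    ; -‿homo = fromℤ-neg
    ; 0-homo = refl
    ; 1-homo = refl
    }

  _coeff≟_ : ∀ i j → Maybe (fromℤ i ≈ fromℤ j)
  i coeff≟ j with i ℤ.≟ j
  ... | yes i≡j = just (reflexive (≡.cong fromℤ i≡j))
  ... | no  _   = nothing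

  module Solver = Algebra.Solver.Ring
    ℤ.+-*-rawRing (fromCommutativeRing commutativeRing) fromℤ-morphism _coeff≟_
  open Solver using (solve; con; _:+_; _:*_; _:-_; :-_; _:=_)

  ≤-cong : ∀ {x x′ y y′} → x ≈ x′ → y ≈ y′ → x ≤ y → x′ ≤ y′
  ≤-cong x≈ y≈ x≤y = ≤-respˡ-≈ x≈ (≤-respʳ-≈ y≈ x≤y)

  <-cong : ∀ {x x′ y y′} → x ≈ x′ → y ≈ y′ → x < y → x′ < y′
  <-cong x≈ y≈ (x≤y , x≉y) =
    ≤-cong x≈ y≈ x≤y , λ x≈y → x≉y (trans x≈ (trans x≈y (sym y≈)))

  ≤⇒0≤- : ∀ {x y} → x ≤ y → 0# ≤ y - x
  ≤⇒0≤- {x} x≤y = ≤-respˡ-≈ (-‿inverseʳ x) (+-monoˡ-≤ (- x) x≤y)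

  0≤-⇒≤ : ∀ {x y} → 0# ≤ y - x → x ≤ y
  0≤-⇒≤ {x} {y} h = ≤-cong (+-identityˡ x)
    (solve 2 (λ x y → (y :- x) :+ x := y) refl x y) (+-monoˡ-≤ x h)

  0≤+ : ∀ {x y} → 0# ≤ x → 0# ≤ y → 0# ≤ x + y
  0≤+ {x} {y} 0≤x 0≤y = ≤-trans 0≤y (≤-respˡ-≈ (+-identityˡ y) (+-monoˡ-≤ y 0≤x))

  ≈0⇒≈ : ∀ {x y} → y - x ≈ 0# → x ≈ y
  ≈0⇒≈ {x} {y} h = begin
    x             ≈⟨ +-identityˡ x ⟨
    0# + x        ≈⟨ +-congʳ h ⟨
    (y - x) + x   ≈⟨ solve 2 (λ x y → (y :- x) :+ x := y) refl x y ⟩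
    y             ∎

  <⇒0<- : ∀ {x y} → x < y → 0# < y - x
  <⇒0<- (x≤y , x≉y) = ≤⇒0≤- x≤y , λ h → x≉y (≈0⇒≈ (sym h))

  0<-⇒< : ∀ {x y} → 0# < y - x → x < y
  0<-⇒< (h , h≉) = 0≤-⇒≤ h , λ x≈y → h≉ (sym (trans (+-congʳ (sym x≈y)) (-‿inverseʳ _)))

  0<⇒≉0 : ∀ {x} → 0# < x → ¬ x ≈ 0#
  0<⇒≉0 (_ , 0≉x) x≈0 = 0≉x (sym x≈0)

  0<+0≤ : ∀ {x y} → 0# < x → 0# ≤ y → 0# < x + y
  0<+0≤ {x} {y} (0≤x , 0≉x) 0≤y = 0≤+ 0≤x 0≤y , λ 0≈x+y → 0≉x (antisym 0≤x
    (≤-cong refl (sym 0≈x+y) (≤-respˡ-≈ (+-identityˡ x)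
      (≤-respʳ-≈ (+-comm y x) (+-monoˡ-≤ x 0≤y)))))

  0<+ : ∀ {x y} → 0# < x → 0# < y → 0# < x + y
  0<+ 0<x 0<y = 0<+0≤ 0<x (proj₁ 0<y)

  0≤1 : 0# ≤ 1#
  0≤1 with total 0# 1#
  ... | inj₁ 0≤1 = 0≤1
  ... | inj₂ 1≤0 = ≤-respʳ-≈
    (solve 0 ((con 0ℤ :- con 1ℤ) :* (con 0ℤ :- con 1ℤ) := con 1ℤ) refl)
    (*-nonneg (≤⇒0≤- 1≤0) (≤⇒0≤- 1≤0))

  0<1 : 0# < 1#
  0<1 = 0≤1 , λ 0≈1 → 1≉0 (sym 0≈1)

  ⁻¹-inverseʳ : ∀ {x} → ¬ x ≈ 0# → x * x ⁻¹ ≈ 1#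
  ⁻¹-inverseʳ {x} x≉0 with x ≟ 0#
  ... | yes x≈0  = contradiction x≈0 x≉0
  ... | no  x≉0′ = proj₂ (inverse x x≉0′)

  ⁻¹-positive : ∀ {x} → 0# < x → 0# < x ⁻¹
  ⁻¹-positive {x} 0<x with total 0# (x ⁻¹)
  ... | inj₁ h = h , λ 0≈i → 1≉0 (begin
    1#          ≈⟨ ⁻¹-inverseʳ (0<⇒≉0 0<x) ⟨
    x * x ⁻¹    ≈⟨ *-congˡ 0≈i ⟨
    x * 0#      ≈⟨ zeroʳ x ⟩
    0#          ∎)
  ... | inj₂ h = contradiction
    (antisym (0≤-⇒≤ (≤-respʳ-≈ 0-≈ (*-nonneg (proj₁ 0<x) (≤⇒0≤- h)))) 0≤1) 1≉0
    where
    0-≈ : x * (0# - x ⁻¹) ≈ 0# - 1#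
    0-≈ = trans
      (solve 2 (λ x i → x :* (con 0ℤ :- i) := con 0ℤ :- x :* i) refl x (x ⁻¹))
      (+-congˡ (-‿cong (⁻¹-inverseʳ (0<⇒≉0 0<x))))

  0<* : ∀ {x y} → 0# < x → 0# < y → 0# < x * y
  0<* {x} {y} 0<x 0<y = *-nonneg (proj₁ 0<x) (proj₁ 0<y) , λ 0≈xy → 0<⇒≉0 0<y (begin
    y                  ≈⟨ *-identityˡ y ⟨
    1# * y             ≈⟨ *-congʳ (⁻¹-inverseʳ (0<⇒≉0 0<x)) ⟨
    (x * x ⁻¹) * y     ≈⟨ solve 3 (λ x y i → (x :* i) :* y := (x :* y) :* i) refl x y (x ⁻¹) ⟩
    (x * y) * x ⁻¹     ≈⟨ *-congʳ 0≈xy ⟨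
    0# * x ⁻¹          ≈⟨ zeroˡ _ ⟩
    0#                 ∎)

  0<fromℕ : ∀ n → 0# < fromℕ (suc n)
  0<fromℕ zero    = 0<1
  0<fromℕ (suc n) = 0<+ (0<fromℕ n) 0<1

  fromℚᵘ-cong : ∀ {u v} → u ℚᵘ.≃ v → fromℚᵘ u ≈ fromℚᵘ v
  fromℚᵘ-cong {ℚᵘ.mkℚᵘ m c} {ℚᵘ.mkℚᵘ n d} (*≡* eq) = begin
    M * C ⁻¹                 ≈⟨ *-identityʳ _ ⟨
    M * C ⁻¹ * 1#            ≈⟨ *-congˡ (⁻¹-inverseʳ (0<⇒≉0 (0<fromℕ d))) ⟨
    M * C ⁻¹ * (D * D ⁻¹)    ≈⟨ solve 4 (λ m c d e → m :* c :* (d :* e) := (m :* d) :* (c :* e)) refl M (C ⁻¹) D (D ⁻¹) ⟩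
    (M * D) * (C ⁻¹ * D ⁻¹)  ≈⟨ *-congʳ cross ⟩
    (N * C) * (C ⁻¹ * D ⁻¹)  ≈⟨ solve 4 (λ n c d e → (n :* c) :* (d :* e) := n :* e :* (c :* d)) refl N C (C ⁻¹) (D ⁻¹) ⟩
    N * D ⁻¹ * (C * C ⁻¹)    ≈⟨ *-congˡ (⁻¹-inverseʳ (0<⇒≉0 (0<fromℕ c))) ⟩
    N * D ⁻¹ * 1#            ≈⟨ *-identityʳ _ ⟩
    N * D ⁻¹                 ∎
    where
    M N C D : Carrier
    M = fromℤ m
    N = fromℤ n
    C = fromℕ (suc c)
    D = fromℕ (suc d)
    cross : M * D ≈ N * C
    cross = trans (sym (fromℤ-* m (+ suc d)))
      (trans (reflexive (≡.cong fromℤ eq)) (fromℤ-* n (+ suc c)))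

  fromℚᵘ-+ : ∀ u v → fromℚᵘ (u ℚᵘ.+ v) ≈ fromℚᵘ u + fromℚᵘ v
  fromℚᵘ-+ (ℚᵘ.mkℚᵘ m c) (ℚᵘ.mkℚᵘ n d) = begin
    fromℤ (m ℤ.* + suc d ℤ.+ n ℤ.* + suc c) * E ⁻¹   ≈⟨ *-congʳ num ⟩
    (M * D + N * C) * E ⁻¹                           ≈⟨ *-identityʳ _ ⟨
    (M * D + N * C) * E ⁻¹ * 1#                      ≈⟨ *-congˡ one ⟨
    (M * D + N * C) * E ⁻¹ * ((C * I) * (D * J))     ≈⟨ solve 7 (λ m n c d i j e → (m :* d :+ n :* c) :* e :* ((c :* i) :* (d :* j)) := (m :* i :* (d :* j) :+ n :* j :* (c :* i)) :* ((c :* d) :* e)) refl M N C D I J (E ⁻¹) ⟩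
    (M * I * (D * J) + N * J * (C * I)) * ((C * D) * E ⁻¹)
                                                     ≈⟨ *-cong (+-cong (*-congˡ DJ) (*-congˡ CI)) (trans (*-congʳ (sym den)) (⁻¹-inverseʳ (0<⇒≉0 0<E))) ⟩
    (M * I * 1# + N * J * 1#) * 1#                   ≈⟨ trans (*-identityʳ _) (+-cong (*-identityʳ _) (*-identityʳ _)) ⟩
    M * I + N * J                                    ∎
    where
    M N C D I J E : Carrier
    M = fromℤ m
    N = fromℤ n
    C = fromℕ (suc c)
    D = fromℕ (suc d)
    I = C ⁻¹
    J = D ⁻¹
    E = fromℕ (suc c ℕ.* suc d)
    0<E : 0# < E
    0<E = 0<fromℕ (d ℕ.+ c ℕ.* suc d)
    CI : C * I ≈ 1#
    CI = ⁻¹-inverseʳ (0<⇒≉0 (0<fromℕ c))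
    DJ : D * J ≈ 1#
    DJ = ⁻¹-inverseʳ (0<⇒≉0 (0<fromℕ d))
    one : (C * I) * (D * J) ≈ 1#
    one = trans (*-cong CI DJ) (*-identityˡ 1#)
    den : E ≈ C * D
    den = ×1-homo-* (suc c) (suc d)
    num : fromℤ (m ℤ.* + suc d ℤ.+ n ℤ.* + suc c) ≈ M * D + N * C
    num = trans (fromℤ-+ (m ℤ.* + suc d) (n ℤ.* + suc c))
      (+-cong (fromℤ-* m (+ suc d)) (fromℤ-* n (+ suc c)))

  fromℚ-+ : ∀ a b → fromℚ (a ℚ.+ b) ≈ fromℚ a + fromℚ b
  fromℚ-+ a b = trans (fromℚᵘ-cong (ℚ.toℚᵘ-homo-+ a b)) (fromℚᵘ-+ (toℚᵘ a) (toℚᵘ b))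

  fromℚ-neg : ∀ a → fromℚ (ℚ.- a) ≈ - fromℚ a
  fromℚ-neg a = trans (fromℚᵘ-cong (ℚ.toℚᵘ-homo‿- a)) (go (toℚᵘ a))
    where
    go : ∀ u → fromℚᵘ (ℚᵘ.- u) ≈ - fromℚᵘ u
    go (ℚᵘ.mkℚᵘ n d) = trans (*-congʳ (fromℤ-neg n)) (sym (-‿distribˡ-* _ _))

  fromℚ-0 : fromℚ 0ℚ ≈ 0#
  fromℚ-0 = zeroˡ _

  LinIndep-rotate : ∀ {x y z} → LinIndep x y z → LinIndep y z x
  LinIndep-rotate {x} {y} {z} li a b c eq = proj₁ (proj₂ zeros) , proj₂ (proj₂ zeros) , proj₁ zeros
    where
    zeros : c ≡ 0ℚ × a ≡ 0ℚ × b ≡ 0ℚ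
    zeros = li c a b (trans
      (solve 3 (λ u v w → w :+ u :+ v := u :+ v :+ w) refl
        (fromℚ a * y) (fromℚ b * z) (fromℚ c * x)) eq)

  LinIndep-swap : ∀ {x y z} → LinIndep x y z → LinIndep y x z
  LinIndep-swap li a b c eq = proj₁ (proj₂ zeros) , proj₁ zeros , proj₂ (proj₂ zeros)
    where
    zeros : b ≡ 0ℚ × a ≡ 0ℚ × c ≡ 0ℚ
    zeros = li b a c (trans (+-congʳ (+-comm _ _)) eq)

  LinIndep-swap₂₃ : ∀ {x y z} → LinIndep x y z → LinIndep x z y
  LinIndep-swap₂₃ li = LinIndep-rotate (LinIndep-swap li)

  LinIndep-sub : ∀ {x y z} → LinIndep x y z → LinIndep (x - y) y z
  LinIndep-sub {x} {y} {z} li a b c eq = proj₁ zeros , b≡0 , proj₂ (proj₂ zeros)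
    where
    zeros : a ≡ 0ℚ × b ℚ.- a ≡ 0ℚ × c ≡ 0ℚ
    zeros = li a (b ℚ.- a) c (begin
      fromℚ a * x + fromℚ (b ℚ.- a) * y + fromℚ c * z
        ≈⟨ +-congʳ (+-congˡ (*-congʳ (trans (fromℚ-+ b (ℚ.- a)) (+-congˡ (fromℚ-neg a))))) ⟩
      fromℚ a * x + (fromℚ b - fromℚ a) * y + fromℚ c * z
        ≈⟨ solve 5 (λ a b x y w → a :* x :+ (b :- a) :* y :+ w := a :* (x :- y) :+ b :* y :+ w)
             refl (fromℚ a) (fromℚ b) x y (fromℚ c * z) ⟩
      fromℚ a * (x - y) + fromℚ b * y + fromℚ c * z
        ≈⟨ eq ⟩
      0# ∎)
    b≡0 : b ≡ 0ℚ
    b≡0 = ≡.trans (≡.sym (ℚ.+-identityʳ b))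
      (≡.subst (λ a → b ℚ.- a ≡ 0ℚ) (proj₁ zeros) (proj₁ (proj₂ zeros)))

  LinIndep-add : ∀ {x y z} → LinIndep x y z → LinIndep (x + y) y z
  LinIndep-add {x} {y} {z} li a b c eq = proj₁ zeros , b≡0 , proj₂ (proj₂ zeros)
    where
    zeros : a ≡ 0ℚ × b ℚ.+ a ≡ 0ℚ × c ≡ 0ℚ
    zeros = li a (b ℚ.+ a) c (begin
      fromℚ a * x + fromℚ (b ℚ.+ a) * y + fromℚ c * z
        ≈⟨ +-congʳ (+-congˡ (*-congʳ (fromℚ-+ b a))) ⟩
      fromℚ a * x + (fromℚ b + fromℚ a) * y + fromℚ c * z
        ≈⟨ solve 5 (λ a b x y w → a :* x :+ (b :+ a) :* y :+ w := a :* (x :+ y) :+ b :* y :+ w)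
             refl (fromℚ a) (fromℚ b) x y (fromℚ c * z) ⟩
      fromℚ a * (x + y) + fromℚ b * y + fromℚ c * z
        ≈⟨ eq ⟩
      0# ∎)
    b≡0 : b ≡ 0ℚ
    b≡0 = ≡.trans (≡.sym (ℚ.+-identityʳ b))
      (≡.subst (λ a → b ℚ.+ a ≡ 0ℚ) (proj₁ zeros) (proj₁ (proj₂ zeros)))

  LinIndep-cong : ∀ {x x′ y y′ z z′} → x ≈ x′ → y ≈ y′ → z ≈ z′ →
                  LinIndep x y z → LinIndep x′ y′ z′
  LinIndep-cong x≈ y≈ z≈ li a b c eq = li a b c
    (trans (+-cong (+-cong (*-congˡ x≈) (*-congˡ y≈)) (*-congˡ z≈)) eq)

  LinIndep⇒≉0 : ∀ {x y z} → LinIndep x y z → ¬ x ≈ 0#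
  LinIndep⇒≉0 {x} {y} {z} li x≈0 with li ℚ.1ℚ 0ℚ 0ℚ (begin
    fromℚ ℚ.1ℚ * x + fromℚ 0ℚ * y + fromℚ 0ℚ * z
      ≈⟨ +-cong (+-cong (*-congˡ x≈0) (*-congʳ fromℚ-0)) (*-congʳ fromℚ-0) ⟩
    fromℚ ℚ.1ℚ * 0# + 0# * y + 0# * z
      ≈⟨ solve 3 (λ o y z → o :* con 0ℤ :+ con 0ℤ :* y :+ con 0ℤ :* z := con 0ℤ) refl (fromℚ ℚ.1ℚ) y z ⟩
    0# ∎)
  ... | () , _

  LinIndep-scale : ∀ {x y z w} → LinIndep (w * x) (w * y) (w * z) → LinIndep x y z
  LinIndep-scale {x} {y} {z} {w} li a b c eq = li a b c (begin
    fromℚ a * (w * x) + fromℚ b * (w * y) + fromℚ c * (w * z)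
      ≈⟨ solve 7 (λ a b c x y z w → a :* (w :* x) :+ b :* (w :* y) :+ c :* (w :* z)
                    := w :* (a :* x :+ b :* y :+ c :* z))
           refl (fromℚ a) (fromℚ b) (fromℚ c) x y z w ⟩
    w * (fromℚ a * x + fromℚ b * y + fromℚ c * z)
      ≈⟨ *-congˡ eq ⟩
    w * 0#
      ≈⟨ zeroʳ w ⟩
    0# ∎)

  0≤^ : ∀ {x} n → 0# ≤ x → 0# ≤ x ^ n
  0≤^ zero    0≤x = 0≤1
  0≤^ (suc n) 0≤x = *-nonneg 0≤x (0≤^ n 0≤x)

  1≤^ : ∀ {x} n → 1# ≤ x → 1# ≤ x ^ n
  1≤^     zero    1≤x = ≤-refl
  1≤^ {x} (suc n) 1≤x = 0≤-⇒≤ (≤-respʳ-≈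
    (solve 2 (λ x y → (x :- con 1ℤ) :* y :+ (y :- con 1ℤ) := x :* y :- con 1ℤ) refl x (x ^ n))
    (0≤+ (*-nonneg (≤⇒0≤- 1≤x) (0≤^ n (≤-trans 0≤1 1≤x))) (≤⇒0≤- (1≤^ n 1≤x))))

  ≤^ : ∀ {x} n .{{_ : NonZero n}} → 1# ≤ x → x ≤ x ^ n
  ≤^ {x} (suc n) 1≤x = 0≤-⇒≤ (≤-respʳ-≈
    (solve 2 (λ x y → x :* (y :- con 1ℤ) := x :* y :- x) refl x (x ^ n))
    (*-nonneg (≤-trans 0≤1 1≤x) (≤⇒0≤- (1≤^ n 1≤x))))

  ≤1+ : ∀ x → x ≤ 1# + x
  ≤1+ x = 0≤-⇒≤ (≤-respʳ-≈ (solve 1 (λ x → con 1ℤ := con 1ℤ :+ x :- x) refl x) 0≤1)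

  -- x ^ (p / q) for x > 0, the positive q-th root of x ^ p.
  rationalPower : (x : Carrier) → 0# < x → (p q : ℕ) → .{{NonZero q}} → Carrier
  rationalPower x 0<x p q = proj₁ (supremum (λ t → 0# ≤ t × t ^ q ≤ x ^ p)
    (0# , ≤-refl , 0^ q)
    (1# + x ^ p , bound))
    where
    0≤x^p : 0# ≤ x ^ p
    0≤x^p = 0≤^ p (proj₁ 0<x)
    0^ : ∀ n .{{_ : NonZero n}} → 0# ^ n ≤ x ^ p
    0^ (suc n) = ≤-respˡ-≈ (sym (zeroˡ _)) 0≤x^p
    bound : ∀ t → 0# ≤ t × t ^ q ≤ x ^ p → t ≤ 1# + x ^ p
    bound t (_ , t^q≤) with total t (1# + x ^ p)
    ... | inj₁ t≤ = t≤
    ... | inj₂ ≤t = ≤-trans (≤^ q 1≤t) (≤-trans t^q≤ (≤1+ _))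
      where
      1≤t : 1# ≤ t
      1≤t = ≤-trans (0≤-⇒≤ (≤-respʳ-≈
        (solve 1 (λ y → y := con 1ℤ :+ y :- con 1ℤ) refl (x ^ p)) 0≤x^p)) ≤t

-- A subfield of ℝ, given as a predicate, with a basis of three elements
-- over ℚ.

record RealCubicField (𝓡 : RealNumbers) : Set₁ where
  open RealNumbers 𝓡
  field
    _∈K       : Carrier → Set
    ∈K-resp-≈ : ∀ {x y} → x ≈ y → x ∈K → y ∈K
    1∈K       : 1# ∈K
    +-closed  : ∀ {x y} → x ∈K → y ∈K → (x + y) ∈K
    neg-closed : ∀ {x} → x ∈K → (- x) ∈K
    *-closed  : ∀ {x y} → x ∈K → y ∈K → (x * y) ∈K
    ⁻¹-closed : ∀ {x} → ¬ x ≈ 0# → x ∈K → (x ⁻¹) ∈K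

    basis     : Fin 3 → Carrier
    basis∈K   : ∀ i → basis i ∈K
    independent : LinIndep (basis 0F) (basis 1F) (basis 2F)
    spanning  : ∀ {x} → x ∈K → ∃ λ (c : Fin 3 → ℚ) →
                x ≈ fromℚ (c 0F) * basis 0F + fromℚ (c 1F) * basis 1F + fromℚ (c 2F) * basis 2F

  -‿closed : ∀ {x y} → x ∈K → y ∈K → (x - y) ∈K
  -‿closed x∈K y∈K = +-closed x∈K (neg-closed y∈K)

  -- Row i holds the coordinates of x * basis i.
  multiplicationMatrix : ∀ {x} → x ∈K → Fin 3 → Fin 3 → ℚ
  multiplicationMatrix x∈K i = proj₁ (spanning (*-closed x∈K (basis∈K i)))

  det : (Fin 3 → Fin 3 → ℚ) → ℚ
  det m = m 0F 0F ℚ.* (m 1F 1F ℚ.* m 2F 2F ℚ.- m 1F 2F ℚ.* m 2F 1F)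
    ℚ.- m 0F 1F ℚ.* (m 1F 0F ℚ.* m 2F 2F ℚ.- m 1F 2F ℚ.* m 2F 0F)
    ℚ.+ m 0F 2F ℚ.* (m 1F 0F ℚ.* m 2F 1F ℚ.- m 1F 1F ℚ.* m 2F 0F)

  -- The norm of x from K to ℚ: the determinant of multiplication by x.
  norm : ∀ {x} → x ∈K → ℚ
  norm x∈K = det (multiplicationMatrix x∈K)

Ind : Set
Ind = Σ[ (i , j) ∈ Fin 3 × Fin 3 ] i ≢ j

data Pair : Set where
  ⟦1,2⟧ ⟦0,1⟧ ⟦0,2⟧ : Pair

module Subtriangles (𝓡 : RealNumbers) where
  open RealNumbers 𝓡

  Point : Set
  Point = Carrier × Carrier

  2# : Carrier
  2# = 1# + 1#

  Δ : Point → Set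
  Δ (x , y) = 0# ≤ x × 0# ≤ y × x + y ≤ 1#

  Side : Ind → Point → Set
  Side ((1F , 2F) , _) (x , y) = y ≤ x
  Side ((2F , 1F) , _) (x , y) = x ≤ y
  Side ((0F , 1F) , _) (x , y) = 2# * x + y - 1# ≤ 0#
  Side ((1F , 0F) , _) (x , y) = 0# ≤ 2# * x + y - 1#
  Side ((0F , 2F) , _) (x , y) = x + 2# * y - 1# ≤ 0#
  Side ((2F , 0F) , _) (x , y) = 0# ≤ x + 2# * y - 1#
  Side ((0F , 0F) , i≢i) = ⊥-elim (i≢i ≡.refl)
  Side ((1F , 1F) , i≢i) = ⊥-elim (i≢i ≡.refl)
  Side ((2F , 2F) , i≢i) = ⊥-elim (i≢i ≡.refl)

  △ : Ind → Point → Set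
  △ e z = Δ z × Side e z

  -- Only used on △ e, where the denominator is positive.
  Tmap : Ind → Point → Point
  Tmap ((1F , 2F) , _) (x , y) = (x - y) / (1# - y) , y / (1# - y)
  Tmap ((2F , 1F) , _) (x , y) = x / (1# - x) , (y - x) / (1# - x)
  Tmap ((0F , 1F) , _) (x , y) = x / (1# - x) , y / (1# - x)
  Tmap ((1F , 0F) , _) (x , y) = (2# * x + y - 1#) / (x + y) , y / (x + y)
  Tmap ((0F , 2F) , _) (x , y) = x / (1# - y) , y / (1# - y)
  Tmap ((2F , 0F) , _) (x , y) = x / (x + y) , (x + 2# * y - 1#) / (x + y)
  Tmap ((0F , 0F) , i≢i) = ⊥-elim (i≢i ≡.refl)
  Tmap ((1F , 1F) , i≢i) = ⊥-elim (i≢i ≡.refl)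
  Tmap ((2F , 2F) , i≢i) = ⊥-elim (i≢i ≡.refl)

  -- When 1, x, y are independent over ℚ the point lies on no dividing line,
  -- so exactly one of the two orders of the pair satisfies Side.
  orient : Pair → Point → Ind
  orient ⟦1,2⟧ (x , y) with y ≤? x
  ... | yes _ = (1F , 2F) , λ ()
  ... | no  _ = (2F , 1F) , λ ()
  orient ⟦0,1⟧ (x , y) with 2# * x + y - 1# ≤? 0#
  ... | yes _ = (0F , 1F) , λ ()
  ... | no  _ = (1F , 0F) , λ ()
  orient ⟦0,2⟧ (x , y) with x + 2# * y - 1# ≤? 0#
  ... | yes _ = (0F , 2F) , λ ()
  ... | no  _ = (2F , 0F) , λ ()

  ≰⇒≥ : ∀ {x y} → ¬ x ≤ y → y ≤ x
  ≰⇒≥ {x} {y} x≰y with total x y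
  ... | inj₁ x≤y = contradiction x≤y x≰y
  ... | inj₂ y≤x = y≤x

  orient-Side : ∀ u z → Side (orient u z) z
  orient-Side ⟦1,2⟧ (x , y) with y ≤? x
  ... | yes h = h
  ... | no  h = ≰⇒≥ h
  orient-Side ⟦0,1⟧ (x , y) with 2# * x + y - 1# ≤? 0#
  ... | yes h = h
  ... | no  h = ≰⇒≥ h
  orient-Side ⟦0,2⟧ (x , y) with x + 2# * y - 1# ≤? 0#
  ... | yes h = h
  ... | no  h = ≰⇒≥ h

  larger : (Pair → Carrier) → Pair → Pair → Pair
  larger v s t with v s ≤? v t
  ... | yes _ = t
  ... | no  _ = s

  argmax : (Pair → Carrier) → Pair
  argmax v = larger v (larger v ⟦1,2⟧ ⟦0,1⟧) ⟦0,2⟧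

  larger-≥ˡ : ∀ (v : Pair → Carrier) s t → v s ≤ v (larger v s t)
  larger-≥ˡ v s t with v s ≤? v t
  ... | yes h = h
  ... | no  _ = ≤-refl

  larger-≥ʳ : ∀ (v : Pair → Carrier) s t → v t ≤ v (larger v s t)
  larger-≥ʳ v s t with v s ≤? v t
  ... | yes _ = ≤-refl
  ... | no  h = ≰⇒≥ h

  argmax-max : ∀ (v : Pair → Carrier) s → v s ≤ v (argmax v)
  argmax-max v ⟦1,2⟧ = ≤-trans (larger-≥ˡ v ⟦1,2⟧ ⟦0,1⟧) (larger-≥ˡ v _ ⟦0,2⟧)
  argmax-max v ⟦0,1⟧ = ≤-trans (larger-≥ʳ v ⟦1,2⟧ ⟦0,1⟧) (larger-≥ˡ v _ ⟦0,2⟧)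
  argmax-max v ⟦0,2⟧ = larger-≥ʳ v _ ⟦0,2⟧

module CubicPoints {𝓡 : RealNumbers} (K : RealCubicField 𝓡) where
  open RealNumbers 𝓡
  open RealProperties 𝓡
  open Solver using (solve; con; _:+_; _:*_; _:-_; :-_; _:=_)
  open Subtriangles 𝓡
  open RealCubicField K hiding (independent)
  open SetoidReasoning setoid

  record InΔK (α β : Carrier) : Set where
    constructor inΔK
    field
      α∈K         : α ∈K
      β∈K         : β ∈K
      independent : LinIndep 1# α β
      0<α         : 0# < α
      0<β         : 0# < β
      α+β<1       : α + β < 1#

    γ : Carrier
    γ = 1# - α - β

    γ∈K : γ ∈K
    γ∈K = -‿closed (-‿closed 1∈K α∈K) β∈K

    0<γ : 0# < γ
    0<γ = <-cong refl (solve 2 (λ α β → con 1ℤ :- (α :+ β) := con 1ℤ :- α :- β) refl α β)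
            (<⇒0<- α+β<1)

    inΔ : Δ (α , β)
    inΔ = proj₁ 0<α , proj₁ 0<β , proj₁ α+β<1

  ΔK : Set
  ΔK = Σ[ (α , β) ∈ Point ] InΔK α β

  projective : ∀ {d m n} → d ∈K → m ∈K → n ∈K → LinIndep d m n →
               0# ≤ m → 0# ≤ n → m + n ≤ d → InΔK (m / d) (n / d)
  projective {d} {m} {n} d∈K m∈K n∈K li 0≤m 0≤n m+n≤d = inΔK
    (*-closed m∈K d⁻¹∈K) (*-closed n∈K d⁻¹∈K)
    (LinIndep-scale (LinIndep-cong (sym (*-identityʳ d)) (cancel m) (cancel n) li))
    (0<* 0<m 0<d⁻¹) (0<* 0<n 0<d⁻¹)
    (0<-⇒< (<-cong refl (begin
      (d - m - n) * d ⁻¹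
        ≈⟨ solve 4 (λ d m n i → (d :- m :- n) :* i := d :* i :- (m :* i :+ n :* i)) refl d m n (d ⁻¹) ⟩
      d * d ⁻¹ - (m / d + n / d)
        ≈⟨ +-congʳ (⁻¹-inverseʳ d≉0) ⟩
      1# - (m / d + n / d) ∎) (0<* 0<d-m-n 0<d⁻¹)))
    where
    d≉0 : ¬ d ≈ 0#
    d≉0 = LinIndep⇒≉0 li
    0<d : 0# < d
    0<d = ≤-trans (0≤+ 0≤m 0≤n) m+n≤d , λ h → d≉0 (sym h)
    0<m : 0# < m
    0<m = 0≤m , λ h → LinIndep⇒≉0 (LinIndep-rotate li) (sym h)
    0<n : 0# < n
    0<n = 0≤n , λ h → LinIndep⇒≉0 (LinIndep-rotate (LinIndep-rotate li)) (sym h)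
    0<d⁻¹ : 0# < d ⁻¹
    0<d⁻¹ = ⁻¹-positive 0<d
    0<d-m-n : 0# < d - m - n
    0<d-m-n =
      ≤-respʳ-≈ (solve 3 (λ d m n → d :- (m :+ n) := d :- m :- n) refl d m n) (≤⇒0≤- m+n≤d) ,
      λ h → LinIndep⇒≉0 (LinIndep-sub (LinIndep-rotate (LinIndep-swap (LinIndep-sub li)))) (sym h)
    d⁻¹∈K : (d ⁻¹) ∈K
    d⁻¹∈K = ⁻¹-closed d≉0 d∈K
    cancel : ∀ k → k ≈ d * (k / d)
    cancel k = sym (begin
      d * (k * d ⁻¹)   ≈⟨ solve 3 (λ d k i → d :* (k :* i) := k :* (d :* i)) refl d k (d ⁻¹) ⟩
      k * (d * d ⁻¹)   ≈⟨ *-congˡ (⁻¹-inverseʳ d≉0) ⟩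
      k * 1#           ≈⟨ *-identityʳ k ⟩
      k                ∎)

  Tmap-closed : ∀ e {x y} → InΔK x y → Side e (x , y) →
                InΔK (proj₁ (Tmap e (x , y))) (proj₂ (Tmap e (x , y)))
  Tmap-closed ((1F , 2F) , _) {x} {y} h y≤x = projective
    (-‿closed 1∈K β∈K) (-‿closed α∈K β∈K) β∈K
    (LinIndep-swap₂₃ (LinIndep-sub (LinIndep-swap (LinIndep-rotate
      (LinIndep-sub (LinIndep-rotate independent))))))
    (≤⇒0≤- y≤x) (proj₁ 0<β)
    (0≤-⇒≤ (≤-respʳ-≈
      (solve 2 (λ x y → con 1ℤ :- (x :+ y) := con 1ℤ :- y :- (x :- y :+ y)) refl x y)
      (≤⇒0≤- (proj₁ α+β<1))))
    where open InΔK h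
  Tmap-closed ((2F , 1F) , _) {x} {y} h x≤y = projective
    (-‿closed 1∈K α∈K) α∈K (-‿closed β∈K α∈K)
    (LinIndep-swap (LinIndep-rotate (LinIndep-sub (LinIndep-swap₂₃
      (LinIndep-rotate (LinIndep-rotate (LinIndep-sub independent)))))))
    (proj₁ 0<α) (≤⇒0≤- x≤y)
    (0≤-⇒≤ (≤-respʳ-≈
      (solve 2 (λ x y → con 1ℤ :- (x :+ y) := con 1ℤ :- x :- (x :+ (y :- x))) refl x y)
      (≤⇒0≤- (proj₁ α+β<1))))
    where open InΔK h
  Tmap-closed ((0F , 1F) , _) {x} {y} h 2x+y-1≤0 = projective
    (-‿closed 1∈K α∈K) α∈K β∈K
    (LinIndep-sub independent)
    (proj₁ 0<α) (proj₁ 0<β)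
    (0≤-⇒≤ (≤-respʳ-≈
      (solve 2 (λ x y → con 0ℤ :- (con (+ 2) :* x :+ y :- con 1ℤ) := con 1ℤ :- x :- (x :+ y)) refl x y)
      (≤⇒0≤- 2x+y-1≤0)))
    where open InΔK h
  Tmap-closed ((1F , 0F) , _) {x} {y} h 0≤2x+y-1 = projective
    (+-closed α∈K β∈K)
    (-‿closed (+-closed (*-closed (+-closed 1∈K 1∈K) α∈K) β∈K) 1∈K) β∈K
    (LinIndep-cong
      (solve 2 (λ x y → con 1ℤ :- x :+ (x :+ y :- (con 1ℤ :- x)) := x :+ y) refl x y)
      (solve 2 (λ x y → x :+ y :- (con 1ℤ :- x) := con (+ 2) :* x :+ y :- con 1ℤ) refl x y)
      refl
      (LinIndep-add (LinIndep-swap (LinIndep-sub (LinIndep-swap₂₃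
        (LinIndep-add (LinIndep-rotate (LinIndep-sub independent))))))))
    0≤2x+y-1 (proj₁ 0<β)
    (0≤-⇒≤ (≤-respʳ-≈
      (solve 2 (λ x y → con 1ℤ :- (x :+ y) := x :+ y :- (con (+ 2) :* x :+ y :- con 1ℤ :+ y)) refl x y)
      (≤⇒0≤- (proj₁ α+β<1))))
    where open InΔK h
  Tmap-closed ((0F , 2F) , _) {x} {y} h x+2y-1≤0 = projective
    (-‿closed 1∈K β∈K) α∈K β∈K
    (LinIndep-swap₂₃ (LinIndep-sub (LinIndep-swap₂₃ independent)))
    (proj₁ 0<α) (proj₁ 0<β)
    (0≤-⇒≤ (≤-respʳ-≈
      (solve 2 (λ x y → con 0ℤ :- (x :+ con (+ 2) :* y :- con 1ℤ) := con 1ℤ :- y :- (x :+ y)) refl x y)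
      (≤⇒0≤- x+2y-1≤0)))
    where open InΔK h
  Tmap-closed ((2F , 0F) , _) {x} {y} h 0≤x+2y-1 = projective
    (+-closed α∈K β∈K) α∈K
    (-‿closed (+-closed α∈K (*-closed (+-closed 1∈K 1∈K) β∈K)) 1∈K)
    (LinIndep-swap₂₃ (LinIndep-cong
      (solve 2 (λ x y → con 1ℤ :- y :+ (y :+ x :- (con 1ℤ :- y)) := x :+ y) refl x y)
      (solve 2 (λ x y → y :+ x :- (con 1ℤ :- y) := x :+ con (+ 2) :* y :- con 1ℤ) refl x y)
      refl
      (LinIndep-add (LinIndep-swap (LinIndep-sub (LinIndep-swap₂₃
        (LinIndep-add (LinIndep-rotate (LinIndep-sub (LinIndep-swap₂₃ independent))))))))))
    (proj₁ 0<α) 0≤x+2y-1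
    (0≤-⇒≤ (≤-respʳ-≈
      (solve 2 (λ x y → con 1ℤ :- (x :+ y) := x :+ y :- (x :+ (x :+ con (+ 2) :* y :- con 1ℤ))) refl x y)
      (≤⇒0≤- (proj₁ α+β<1))))
    where open InΔK h
  Tmap-closed ((0F , 0F) , i≢i) = ⊥-elim (i≢i ≡.refl)
  Tmap-closed ((1F , 1F) , i≢i) = ⊥-elim (i≢i ≡.refl)
  Tmap-closed ((2F , 2F) , i≢i) = ⊥-elim (i≢i ≡.refl)

-- The exponent is r = p / q.
module Algorithm {𝓡 : RealNumbers} (K : RealCubicField 𝓡) (p q : ℕ) .{{_ : NonZero q}} where
  open RealNumbers 𝓡
  open RealProperties 𝓡
  open Subtriangles 𝓡
  open RealCubicField K using (norm)
  open CubicPoints K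

  v : ΔK → Pair → Carrier
  v ((α , β) , h) = λ where
      ⟦1,2⟧ → (αʳ * βʳ) / fromℚ ℚ.∣ norm α∈K ℚ.* norm β∈K ∣
      ⟦0,1⟧ → (αʳ * γʳ) / fromℚ ℚ.∣ norm α∈K ℚ.* norm γ∈K ∣
      ⟦0,2⟧ → (βʳ * γʳ) / fromℚ ℚ.∣ norm β∈K ℚ.* norm γ∈K ∣
    where
    open InΔK h
    αʳ βʳ γʳ : Carrier
    αʳ = rationalPower α 0<α p q
    βʳ = rationalPower β 0<β p q
    γʳ = rationalPower γ 0<γ p q

  -- If 3 ∤ p, the maximum of v z is attained only once, so that the
  -- tie-breaking in argmax plays no role.
  ε : ΔK → Ind
  ε z = orient (argmax (v z)) (proj₁ z)

  ε-△ : ∀ z → △ (ε z) (proj₁ z)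
  ε-△ z = InΔK.inΔ (proj₂ z) , orient-Side (argmax (v z)) (proj₁ z)

  T : ΔK → ΔK
  T z = Tmap (ε z) (proj₁ z) , Tmap-closed (ε z) (proj₂ z) (proj₂ (ε-△ z))

  T^ : ℕ → ΔK → ΔK
  T^ n z = fold z T n

Matrix : Set
Matrix = Fin 3 → Fin 3 → ℤ

infixl 7 _⊗_
infixr 7 _·_

_⊗_ : Matrix → Matrix → Matrix
(A ⊗ B) k l = A k 0F ℤ.* B 0F l ℤ.+ A k 1F ℤ.* B 1F l ℤ.+ A k 2F ℤ.* B 2F l

_·_ : Matrix → Vec ℤ 3 → Vec ℤ 3
A · x = tabulate λ k →
  A k 0F ℤ.* lookup x 0F ℤ.+ A k 1F ℤ.* lookup x 1F ℤ.+ A k 2F ℤ.* lookup x 2F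

I₃ : Matrix
I₃ k l = if ⌊ k Fin.≟ l ⌋ then 1ℤ else 0ℤ

M : Fin 3 → Fin 3 → Matrix
M i j k l = if ⌊ (k Fin.≟ l) ⊎-dec ((k Fin.≟ i) ×-dec (l Fin.≟ j)) ⌋ then 1ℤ else 0ℤ

L : Fin 3 → Fin 3 → Matrix
L i j = M j i

L⁻¹ : Fin 3 → Fin 3 → Matrix
L⁻¹ i j k l = if ⌊ (k Fin.≟ j) ×-dec (l Fin.≟ i) ⌋ then -1ℤ else I₃ k l

L⊗L⁻¹ : ∀ i j → i ≢ j → ∀ k l → (L i j ⊗ L⁻¹ i j) k l ≡ I₃ k l
L⊗L⁻¹ = from-yes (all? λ i → all? λ j → ¬? (i Fin.≟ j) →-dec
  all? λ k → all? λ l → (L i j ⊗ L⁻¹ i j) k l ℤ.≟ I₃ k l)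

L⁻¹⊗L : ∀ i j → i ≢ j → ∀ k l → (L⁻¹ i j ⊗ L i j) k l ≡ I₃ k l
L⁻¹⊗L = from-yes (all? λ i → all? λ j → ¬? (i Fin.≟ j) →-dec
  all? λ k → all? λ l → (L⁻¹ i j ⊗ L i j) k l ℤ.≟ I₃ k l)

e : Fin 3 → Vec ℤ 3
e i = tabulate (I₃ i)

-- The pair (x , i) stands for the square (x, i*) in ℝ³, which it
-- determines and is determined by.
UnitSquare : Set
UnitSquare = Vec ℤ 3 × Fin 3

_≟□_ : DecidableEquality UnitSquare
_≟□_ = Product.≡-dec (Vec.≡-dec ℤ._≟_) Fin._≟_

-- A list may repeat a square; only the total coefficients are significant.
FormalSum : Set
FormalSum = List (ℤ × UnitSquare)

coeff : FormalSum → UnitSquare → ℤ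
coeff []            ρ = 0ℤ
coeff ((c , σ) ∷ f) ρ = (if ⌊ σ ≟□ ρ ⌋ then c else 0ℤ) ℤ.+ coeff f ρ

infix 4 _≋_ _occursIn_ _≺_ _≻_

_≋_ : FormalSum → FormalSum → Set
f ≋ g = ∀ ρ → coeff f ρ ≡ coeff g ρ

_occursIn_ : UnitSquare → FormalSum → Set
ρ occursIn f = coeff f ρ ≢ 0ℤ

Patch : FormalSum → Set
Patch f = ∀ ρ → coeff f ρ ≡ 0ℤ ⊎ coeff f ρ ≡ 1ℤ

_≺_ : FormalSum → FormalSum → Set
f ≺ g = Patch f × Patch g × (∀ ρ → ρ occursIn f → ρ occursIn g)

_≻_ : FormalSum → FormalSum → Set
g ≻ f = f ≺ g

⟪_⟫ : UnitSquare → FormalSum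
⟪ σ ⟫ = (1ℤ , σ) ∷ []

Θ□ : Ind → UnitSquare → FormalSum
Θ□ ((i , j) , _) (x , k) = if ⌊ k Fin.≟ j ⌋
  then (1ℤ , L⁻¹ i j · zipWith ℤ._+_ x (e i) , i) ∷ (1ℤ , L⁻¹ i j · x , j) ∷ []
  else (1ℤ , L⁻¹ i j · x , k) ∷ []

Θ : Ind → FormalSum → FormalSum
Θ ij = concatMap λ (c , σ) → map (λ (d , ρ) → c ℤ.* d , ρ) (Θ□ ij σ)

module SteppedSurface {𝓡 : RealNumbers} (K : RealCubicField 𝓡) where
  open RealNumbers 𝓡
  open CubicPoints K

  ν : ΔK → Vec Carrier 3
  ν ((α , β) , _) = 1# - α - β ∷ α ∷ β ∷ []

  ⟨_,_⟩ : Vec ℤ 3 → Vec Carrier 3 → Carrier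
  ⟨ x , a ⟩ = fromℤ (lookup x 0F) * lookup a 0F
    + fromℤ (lookup x 1F) * lookup a 1F
    + fromℤ (lookup x 2F) * lookup a 2F

  𝒮 : Vec Carrier 3 → UnitSquare → Set
  𝒮 a (x , i) = 0# < ⟨ x , a ⟩ × ⟨ zipWith ℤ._-_ x (e i) , a ⟩ ≤ 0#

  -- 𝒢(a) as the submodule of the formal sums of arbitrary unit squares.
  𝒢 : Vec Carrier 3 → FormalSum → Set
  𝒢 a f = ∃ λ g → All (λ (_ , σ) → 𝒮 a σ) g × f ≋ g

{-# OPTIONS --safe #-}
module Submission where

-- Write a = ν(αₙ, βₙ), a′ = ν(αₙ₊₁, βₙ₊₁) and εₙ = (i, j).  Clearing denominators
-- in T gives a = d · ᵗL a′ with d > 0, so ⟨z, a⟩ = d ⟨L z, a′⟩.  As L eₖ = eₖ for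
-- k ≠ i and L eᵢ = eᵢ + eⱼ, the square (z, k*) with k ≠ i lies in 𝒮(a) exactly
-- when (L z, k*) lies in 𝒮(a′), while (z, i*) lies in 𝒮(a) exactly when
-- 0 < ⟨L z, a′⟩ ≤ a′ᵢ + a′ⱼ.  The squares whose image contains (z, k*) are
-- (L z, k*) and, for k = i, also (L z − eᵢ, j*).  These two split the interval
-- (0, a′ᵢ + a′ⱼ] at a′ᵢ, so exactly one of them lies in 𝒮(a′).

open import Data.Bool.Base using (if_then_else_)
open import Data.Empty using (⊥)
open import Data.Fin.Base using (Fin)
open import Data.Fin.Patterns using (0F; 1F; 2F)
open import Data.Fin.Properties as Fin using (all?)
open import Data.Integer.Base as ℤ using (ℤ; 0ℤ; 1ℤ)
import Data.Integer.Properties as ℤ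
open import Data.Integer.Tactic.RingSolver using (solve-∀)
open import Data.List.Base using (List; []; _∷_; map)
import Data.List.Membership.DecPropositional as DecPropositional
open import Data.List.Membership.Propositional using (_∈_; _∉_)
open import Data.List.Relation.Unary.All as All using (All; []; _∷_)
open import Data.List.Relation.Unary.All.Properties as All using (All¬⇒¬Any)
open import Data.List.Relation.Unary.Any using (here; there)
open import Data.List.Relation.Unary.AllPairs using ([]; _∷_)
open import Data.List.Relation.Unary.Unique.Propositional using (Unique)
open import Data.Nat.Base using (ℕ; suc; NonZero)
open import Data.Nat.Coprimality using (Coprime)
open import Data.Nat.Divisibility using (_∣_)
open import Data.Nat.GeneralisedArithmetic using (fold)
open import Data.Product.Base using (∃; _×_; _,_; proj₁; proj₂)
open import Data.Sum.Base using (_⊎_; inj₁; inj₂)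
open import Data.Vec.Base using (Vec; []; _∷_; lookup; zipWith)
import Data.Vec.Properties as Vec
open import Function.Base using (_∘_)
open import Relation.Binary.PropositionalEquality as ≡ using (_≡_; _≢_; refl; cong; cong₂; subst)
import Relation.Binary.Reasoning.Setoid as SetoidReasoning
open import Relation.Nullary.Decidable using (Dec; yes; no; ⌊_⌋; ¬?; _→-dec_; from-yes)
open import Relation.Nullary.Negation using (¬_; contradiction)
open import Defs

-- Integer vectors and matrices.

infixl 6 _⊞_ _⊟_

_⊞_ _⊟_ : Vec ℤ 3 → Vec ℤ 3 → Vec ℤ 3
_⊞_ = zipWith ℤ._+_
_⊟_ = zipWith ℤ._-_

vec₃-≡ : ∀ {A : Set} {a a′ b b′ c c′ : A} → a ≡ a′ → b ≡ b′ → c ≡ c′ →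
         _≡_ {A = Vec A 3} (a ∷ b ∷ c ∷ []) (a′ ∷ b′ ∷ c′ ∷ [])
vec₃-≡ refl refl refl = refl

⊟-⊞ : ∀ x y z → x ⊟ (y ⊞ z) ≡ x ⊟ y ⊟ z
⊟-⊞ (a ∷ b ∷ c ∷ []) (a′ ∷ b′ ∷ c′ ∷ []) (a″ ∷ b″ ∷ c″ ∷ []) = vec₃-≡ (eq a a′ a″) (eq b b′ b″) (eq c c′ c″)
  where
  eq : ∀ a b c → a ℤ.- (b ℤ.+ c) ≡ a ℤ.- b ℤ.- c
  eq = solve-∀

⊞-⊟-cancel : ∀ x y → x ⊞ y ⊟ y ≡ x
⊞-⊟-cancel (a ∷ b ∷ c ∷ []) (a′ ∷ b′ ∷ c′ ∷ []) = vec₃-≡ (eq a a′) (eq b b′) (eq c c′)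
  where
  eq : ∀ a b → a ℤ.+ b ℤ.- b ≡ a
  eq = solve-∀

⊟-⊞-cancel : ∀ x y → x ⊟ y ⊞ y ≡ x
⊟-⊞-cancel (a ∷ b ∷ c ∷ []) (a′ ∷ b′ ∷ c′ ∷ []) = vec₃-≡ (eq a a′) (eq b b′) (eq c c′)
  where
  eq : ∀ a b → a ℤ.- b ℤ.+ b ≡ a
  eq = solve-∀

-- Here and in ·-⊗ components are rewritten through propositional hypotheses:
-- left to the conversion checker, nested integer expressions get unfolded.
·-distrib-⊟ : ∀ A x y → A · (x ⊟ y) ≡ A · x ⊟ A · y
·-distrib-⊟ A x y = vec₃-≡ (row 0F) (row 1F) (row 2F)
  where
  ring : ∀ a b c x y z x′ y′ z′ →
    a ℤ.* (x ℤ.- x′) ℤ.+ b ℤ.* (y ℤ.- y′) ℤ.+ c ℤ.* (z ℤ.- z′) ≡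
    (a ℤ.* x ℤ.+ b ℤ.* y ℤ.+ c ℤ.* z) ℤ.- (a ℤ.* x′ ℤ.+ b ℤ.* y′ ℤ.+ c ℤ.* z′)
  ring = solve-∀
  eq : ∀ a b c x y z x′ y′ z′ {u v w} → u ≡ x ℤ.- x′ → v ≡ y ℤ.- y′ → w ≡ z ℤ.- z′ →
    a ℤ.* u ℤ.+ b ℤ.* v ℤ.+ c ℤ.* w ≡
    (a ℤ.* x ℤ.+ b ℤ.* y ℤ.+ c ℤ.* z) ℤ.- (a ℤ.* x′ ℤ.+ b ℤ.* y′ ℤ.+ c ℤ.* z′)
  eq a b c x y z x′ y′ z′ refl refl refl = ring a b c x y z x′ y′ z′
  row : ∀ k →
    A k 0F ℤ.* lookup (x ⊟ y) 0F ℤ.+ A k 1F ℤ.* lookup (x ⊟ y) 1F ℤ.+ A k 2F ℤ.* lookup (x ⊟ y) 2F ≡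
    (A k 0F ℤ.* lookup x 0F ℤ.+ A k 1F ℤ.* lookup x 1F ℤ.+ A k 2F ℤ.* lookup x 2F) ℤ.-
    (A k 0F ℤ.* lookup y 0F ℤ.+ A k 1F ℤ.* lookup y 1F ℤ.+ A k 2F ℤ.* lookup y 2F)
  row k = eq (A k 0F) (A k 1F) (A k 2F) (lookup x 0F) (lookup x 1F) (lookup x 2F)
    (lookup y 0F) (lookup y 1F) (lookup y 2F)
    (Vec.lookup-zipWith ℤ._-_ 0F x y) (Vec.lookup-zipWith ℤ._-_ 1F x y) (Vec.lookup-zipWith ℤ._-_ 2F x y)

·-⊗ : ∀ A B x → A · (B · x) ≡ (A ⊗ B) · x
·-⊗ A B x = Vec.tabulate-cong row
  where
  ring : ∀ a a′ a″ b₀ b₁ b₂ b₀′ b₁′ b₂′ b₀″ b₁″ b₂″ x y z →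
    a ℤ.* (b₀ ℤ.* x ℤ.+ b₁ ℤ.* y ℤ.+ b₂ ℤ.* z) ℤ.+ a′ ℤ.* (b₀′ ℤ.* x ℤ.+ b₁′ ℤ.* y ℤ.+ b₂′ ℤ.* z)
      ℤ.+ a″ ℤ.* (b₀″ ℤ.* x ℤ.+ b₁″ ℤ.* y ℤ.+ b₂″ ℤ.* z) ≡
    (a ℤ.* b₀ ℤ.+ a′ ℤ.* b₀′ ℤ.+ a″ ℤ.* b₀″) ℤ.* x ℤ.+ (a ℤ.* b₁ ℤ.+ a′ ℤ.* b₁′ ℤ.+ a″ ℤ.* b₁″) ℤ.* y
      ℤ.+ (a ℤ.* b₂ ℤ.+ a′ ℤ.* b₂′ ℤ.+ a″ ℤ.* b₂″) ℤ.* z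
  ring = solve-∀
  eq : ∀ a a′ a″ b₀ b₁ b₂ b₀′ b₁′ b₂′ b₀″ b₁″ b₂″ x y z {u v w} →
    u ≡ b₀ ℤ.* x ℤ.+ b₁ ℤ.* y ℤ.+ b₂ ℤ.* z →
    v ≡ b₀′ ℤ.* x ℤ.+ b₁′ ℤ.* y ℤ.+ b₂′ ℤ.* z →
    w ≡ b₀″ ℤ.* x ℤ.+ b₁″ ℤ.* y ℤ.+ b₂″ ℤ.* z →
    a ℤ.* u ℤ.+ a′ ℤ.* v ℤ.+ a″ ℤ.* w ≡
    (a ℤ.* b₀ ℤ.+ a′ ℤ.* b₀′ ℤ.+ a″ ℤ.* b₀″) ℤ.* x ℤ.+ (a ℤ.* b₁ ℤ.+ a′ ℤ.* b₁′ ℤ.+ a″ ℤ.* b₁″) ℤ.* y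
      ℤ.+ (a ℤ.* b₂ ℤ.+ a′ ℤ.* b₂′ ℤ.+ a″ ℤ.* b₂″) ℤ.* z
  eq a a′ a″ b₀ b₁ b₂ b₀′ b₁′ b₂′ b₀″ b₁″ b₂″ x y z refl refl refl =
    ring a a′ a″ b₀ b₁ b₂ b₀′ b₁′ b₂′ b₀″ b₁″ b₂″ x y z
  entry : ∀ k l → (A ⊗ B) k l ≡ A k 0F ℤ.* B 0F l ℤ.+ A k 1F ℤ.* B 1F l ℤ.+ A k 2F ℤ.* B 2F l
  entry k l = refl
  row : ∀ k →
    A k 0F ℤ.* lookup (B · x) 0F ℤ.+ A k 1F ℤ.* lookup (B · x) 1F ℤ.+ A k 2F ℤ.* lookup (B · x) 2F ≡
    (A ⊗ B) k 0F ℤ.* lookup x 0F ℤ.+ (A ⊗ B) k 1F ℤ.* lookup x 1F ℤ.+ (A ⊗ B) k 2F ℤ.* lookup x 2F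
  row k = ≡.trans
    (eq (A k 0F) (A k 1F) (A k 2F) (B 0F 0F) (B 0F 1F) (B 0F 2F)
      (B 1F 0F) (B 1F 1F) (B 1F 2F) (B 2F 0F) (B 2F 1F) (B 2F 2F)
      (lookup x 0F) (lookup x 1F) (lookup x 2F) refl refl refl)
    (cong₂ ℤ._+_ (cong₂ ℤ._+_ (cong (ℤ._* lookup x 0F) (≡.sym (entry k 0F)))
      (cong (ℤ._* lookup x 1F) (≡.sym (entry k 1F)))) (cong (ℤ._* lookup x 2F) (≡.sym (entry k 2F))))

-- Matrices are functions, so `L⊗L⁻¹` and `L⁻¹⊗L` give only entrywise equality; this carries it over
-- to products with vectors.
·-congˡ : ∀ {A B} → (∀ k l → A k l ≡ B k l) → ∀ x → A · x ≡ B · x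
·-congˡ A≗B x = Vec.tabulate-cong λ k →
  cong₂ ℤ._+_ (cong₂ ℤ._+_ (cong (ℤ._* lookup x 0F) (A≗B k 0F)) (cong (ℤ._* lookup x 1F) (A≗B k 1F)))
    (cong (ℤ._* lookup x 2F) (A≗B k 2F))

I₃·x≡x : ∀ x → I₃ · x ≡ x
I₃·x≡x (x ∷ y ∷ z ∷ []) = vec₃-≡ (eq₀ x y z) (eq₁ x y z) (eq₂ x y z)
  where
  eq₀ : ∀ x y z → 1ℤ ℤ.* x ℤ.+ 0ℤ ℤ.* y ℤ.+ 0ℤ ℤ.* z ≡ x
  eq₀ = solve-∀
  eq₁ : ∀ x y z → 0ℤ ℤ.* x ℤ.+ 1ℤ ℤ.* y ℤ.+ 0ℤ ℤ.* z ≡ y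
  eq₁ = solve-∀
  eq₂ : ∀ x y z → 0ℤ ℤ.* x ℤ.+ 0ℤ ℤ.* y ℤ.+ 1ℤ ℤ.* z ≡ z
  eq₂ = solve-∀

-- Inverse and columns of `L`.

L·L⁻¹·x≡x : ∀ {i j} → i ≢ j → ∀ x → L i j · L⁻¹ i j · x ≡ x
L·L⁻¹·x≡x {i} {j} i≢j x = ≡.trans (·-⊗ (L i j) (L⁻¹ i j) x)
  (≡.trans (·-congˡ (L⊗L⁻¹ i j i≢j) x) (I₃·x≡x x))

L⁻¹·L·x≡x : ∀ {i j} → i ≢ j → ∀ x → L⁻¹ i j · L i j · x ≡ x
L⁻¹·L·x≡x {i} {j} i≢j x = ≡.trans (·-⊗ (L⁻¹ i j) (L i j) x)
  (≡.trans (·-congˡ (L⁻¹⊗L i j i≢j) x) (I₃·x≡x x))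

-- The only off-diagonal 1 of `L i j = M j i` sits in row `j`, column `i`, so every other column is
-- that of the identity. The finitely many cases are decided by evaluation.
L·eₖ : ∀ i j k → k ≢ i → L i j · e k ≡ e k
L·eₖ = from-yes (all? λ i → all? λ j → all? λ k → ¬? (k Fin.≟ i) →-dec
  Vec.≡-dec ℤ._≟_ (L i j · e k) (e k))

L·eᵢ : ∀ i j → i ≢ j → L i j · e i ≡ e i ⊞ e j
L·eᵢ = from-yes (all? λ i → all? λ j → ¬? (i Fin.≟ j) →-dec
  Vec.≡-dec ℤ._≟_ (L i j · e i) (e i ⊞ e j))

-- Lists of distinct squares as patches.

sum-of : List UnitSquare → FormalSum
sum-of = map (1ℤ ,_)

coeff-∉ : ∀ {ρ} ρs → ρ ∉ ρs → coeff (sum-of ρs) ρ ≡ 0ℤ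
coeff-∉     []       ρ∉ = refl
coeff-∉ {ρ} (σ ∷ ρs) ρ∉ with σ ≟□ ρ
... | yes σ≡ρ = contradiction (here (≡.sym σ≡ρ)) ρ∉
... | no  _   = ≡.trans (ℤ.+-identityˡ _) (coeff-∉ ρs (ρ∉ ∘ there))

coeff-∈ : ∀ {ρ ρs} → Unique ρs → ρ ∈ ρs → coeff (sum-of ρs) ρ ≡ 1ℤ
coeff-∈ {ρ} {σ ∷ ρs} (σ∉ ∷ unique) ρ∈ with σ ≟□ ρ | ρ∈
... | yes refl | _         = cong (λ c → 1ℤ ℤ.+ c) (coeff-∉ ρs (All¬⇒¬Any σ∉))
... | no  σ≢ρ  | here ρ≡σ  = contradiction (≡.sym ρ≡σ) σ≢ρ
... | no  _    | there ρ∈ρs = ≡.trans (ℤ.+-identityˡ _) (coeff-∈ unique ρ∈ρs)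

open DecPropositional _≟□_ using (_∈?_)

occursIn⇒∈ : ∀ {ρ} ρs → ρ occursIn sum-of ρs → ρ ∈ ρs
occursIn⇒∈ {ρ} ρs occurs with ρ ∈? ρs
... | yes ρ∈ = ρ∈
... | no  ρ∉ = contradiction (coeff-∉ ρs ρ∉) occurs

∈⇒occursIn : ∀ {ρ ρs} → Unique ρs → ρ ∈ ρs → ρ occursIn sum-of ρs
∈⇒occursIn unique ρ∈ eq with () ← ≡.trans (≡.sym eq) (coeff-∈ unique ρ∈)

Unique⇒Patch : ∀ {ρs} → Unique ρs → Patch (sum-of ρs)
Unique⇒Patch {ρs} unique ρ with ρ ∈? ρs
... | yes ρ∈ = inj₂ (coeff-∈ unique ρ∈)
... | no  ρ∉ = inj₁ (coeff-∉ ρs ρ∉)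

≻⟪⟫ : ∀ {ρ ρs} → Unique ρs → ρ ∈ ρs → sum-of ρs ≻ ⟪ ρ ⟫
≻⟪⟫ {ρ} {ρs} unique ρ∈ = Unique⇒Patch {ρ ∷ []} ([] ∷ []) , Unique⇒Patch unique , λ σ occurs →
  ∈⇒occursIn unique (subst (_∈ ρs) (≡.sym (only (occursIn⇒∈ (ρ ∷ []) occurs))) ρ∈)
  where
  only : ∀ {σ} → σ ∈ ρ ∷ [] → σ ≡ ρ
  only (here eq) = eq

-- Images of unit squares and their candidate preimages.

module _ {i j : Fin 3} (i≢j : i ≢ j) where

  -- The support of the image under `Θ`, kept as a list so that occurrence becomes list membership
  -- and coefficients disappear from the argument.
  squares : UnitSquare → List UnitSquare
  squares (x , k) = if ⌊ k Fin.≟ j ⌋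
    then (L⁻¹ i j · (x ⊞ e i) , i) ∷ (L⁻¹ i j · x , j) ∷ []
    else (L⁻¹ i j · x , k) ∷ []

  Θ-squares : ∀ σ → Θ ((i , j) , i≢j) ⟪ σ ⟫ ≡ sum-of (squares σ)
  Θ-squares (x , k) with k Fin.≟ j
  ... | yes _ = refl
  ... | no  _ = refl

  -- When the image has two squares, their types `i` and `j` differ.
  squares-unique : ∀ σ → Unique (squares σ)
  squares-unique (x , k) with k Fin.≟ j
  ... | yes _ = ((i≢j ∘ cong proj₂) ∷ []) ∷ [] ∷ []
  ... | no  _ = [] ∷ []

  -- A listed square has `z = L⁻¹ x` or `z = L⁻¹ (x + eᵢ)`; applying `L` solves for `x`.
  ∈-squares⁻ : ∀ {z k} σ → (z , k) ∈ squares σ →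
               σ ≡ (L i j · z , k) ⊎ (k ≡ i × σ ≡ (L i j · z ⊟ e i , j))
  ∈-squares⁻ (x , l) mem with l Fin.≟ j | mem
  ... | yes refl | here refl = inj₂ (refl , cong (_, j) (≡.sym
    (≡.trans (cong (_⊟ e i) (L·L⁻¹·x≡x i≢j _)) (⊞-⊟-cancel x (e i)))))
  ... | yes refl | there (here refl) = inj₁ (cong (_, j) (≡.sym (L·L⁻¹·x≡x i≢j x)))
  ... | no _     | here refl = inj₁ (cong (_, l) (≡.sym (L·L⁻¹·x≡x i≢j x)))

  ∈-squares⁺ˡ : ∀ z k → (z , k) ∈ squares (L i j · z , k)
  ∈-squares⁺ˡ z k with k Fin.≟ j
  ... | yes refl = there (here (cong (_, k) (≡.sym (L⁻¹·L·x≡x i≢j z))))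
  ... | no  _    = here (cong (_, k) (≡.sym (L⁻¹·L·x≡x i≢j z)))

  ∈-squares⁺ʳ : ∀ z → (z , i) ∈ squares (L i j · z ⊟ e i , j)
  ∈-squares⁺ʳ z with j Fin.≟ j
  ... | yes _  = here (cong (_, i) (≡.sym
    (≡.trans (cong (L⁻¹ i j ·_) (⊟-⊞-cancel (L i j · z) (e i))) (L⁻¹·L·x≡x i≢j z))))
  ... | no j≢j = contradiction refl j≢j

module Descent {𝓡 : RealNumbers} (K : RealCubicField 𝓡) where
  open RealNumbers 𝓡 hiding (refl)
  open RealNumbers 𝓡 using () renaming (refl to ≈-refl)
  open RealProperties 𝓡
  open Solver using (solve; con; _:+_; _:*_; _:-_; _:=_; Polynomial)
  open Subtriangles 𝓡
  open CubicPoints K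
  open SteppedSurface K
  open SetoidReasoning setoid

  -- Linearity of the pairing and positivity of `ν`.

  ⟨⊟⟩ : ∀ x y a → ⟨ x ⊟ y , a ⟩ ≈ ⟨ x , a ⟩ - ⟨ y , a ⟩
  ⟨⊟⟩ (x₀ ∷ x₁ ∷ x₂ ∷ []) (y₀ ∷ y₁ ∷ y₂ ∷ []) (a₀ ∷ a₁ ∷ a₂ ∷ []) = trans
    (+-cong (+-cong (*-congʳ (fromℤ-- x₀ y₀)) (*-congʳ (fromℤ-- x₁ y₁))) (*-congʳ (fromℤ-- x₂ y₂)))
    (solve 9 (λ x₀ x₁ x₂ y₀ y₁ y₂ a₀ a₁ a₂ →
      (x₀ :- y₀) :* a₀ :+ (x₁ :- y₁) :* a₁ :+ (x₂ :- y₂) :* a₂ :=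
      (x₀ :* a₀ :+ x₁ :* a₁ :+ x₂ :* a₂) :- (y₀ :* a₀ :+ y₁ :* a₁ :+ y₂ :* a₂)) ≈-refl
      (fromℤ x₀) (fromℤ x₁) (fromℤ x₂) (fromℤ y₀) (fromℤ y₁) (fromℤ y₂) a₀ a₁ a₂)
    where
    fromℤ-- : ∀ m n → fromℤ (m ℤ.- n) ≈ fromℤ m - fromℤ n
    fromℤ-- m n = trans (fromℤ-+ m (ℤ.- n)) (+-congˡ (fromℤ-neg n))

  ⟨e⟩ : ∀ k a → ⟨ e k , a ⟩ ≈ lookup a k
  ⟨e⟩ 0F (a ∷ b ∷ c ∷ []) =
    solve 3 (λ a b c → con 1ℤ :* a :+ con 0ℤ :* b :+ con 0ℤ :* c := a) ≈-refl a b c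
  ⟨e⟩ 1F (a ∷ b ∷ c ∷ []) =
    solve 3 (λ a b c → con 0ℤ :* a :+ con 1ℤ :* b :+ con 0ℤ :* c := b) ≈-refl a b c
  ⟨e⟩ 2F (a ∷ b ∷ c ∷ []) =
    solve 3 (λ a b c → con 0ℤ :* a :+ con 0ℤ :* b :+ con 1ℤ :* c := c) ≈-refl a b c

  0<⟨e,ν⟩ : ∀ k w → 0# < ⟨ e k , ν w ⟩
  0<⟨e,ν⟩ k (p , h) = <-cong ≈-refl (sym (⟨e⟩ k (ν (p , h)))) (0<lookup k)
    where
    0<lookup : ∀ k → 0# < lookup (ν (p , h)) k
    0<lookup 0F = InΔK.0<γ h
    0<lookup 1F = InΔK.0<α h
    0<lookup 2F = InΔK.0<β h

  -- The map `T` seen through the pairing.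

  form : ∀ {n} → Matrix → (z₀ z₁ z₂ b₀ b₁ b₂ : Polynomial n) → Polynomial n
  form A z₀ z₁ z₂ b₀ b₁ b₂ = row 0F :* b₀ :+ row 1F :* b₁ :+ row 2F :* b₂
    where row = λ k → con (A k 0F) :* z₀ :+ con (A k 1F) :* z₁ :+ con (A k 2F) :* z₂

  -- The pairing `⟨ A · z , b ⟩` with `fromℤ` pushed down to the entries, which is the shape that
  -- the solver polynomial `form` evaluates to.
  expanded-form : Matrix → Vec ℤ 3 → Vec Carrier 3 → Carrier
  expanded-form A z b = row 0F * lookup b 0F + row 1F * lookup b 1F + row 2F * lookup b 2F
    where
    row : Fin 3 → Carrier
    row k = fromℤ (A k 0F) * fromℤ (lookup z 0F) + fromℤ (A k 1F) * fromℤ (lookup z 1F)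
          + fromℤ (A k 2F) * fromℤ (lookup z 2F)

  ⟨·⟩ : ∀ A z b → ⟨ A · z , b ⟩ ≈ expanded-form A z b
  ⟨·⟩ A (z₀ ∷ z₁ ∷ z₂ ∷ []) b =
    +-cong (+-cong (*-congʳ (row 0F)) (*-congʳ (row 1F))) (*-congʳ (row 2F))
    where
    row : ∀ k → fromℤ (A k 0F ℤ.* z₀ ℤ.+ A k 1F ℤ.* z₁ ℤ.+ A k 2F ℤ.* z₂) ≈ _
    row k = trans (fromℤ-+ (A k 0F ℤ.* z₀ ℤ.+ A k 1F ℤ.* z₁) (A k 2F ℤ.* z₂))
      (+-cong (trans (fromℤ-+ (A k 0F ℤ.* z₀) (A k 1F ℤ.* z₁))
        (+-cong (fromℤ-* (A k 0F) z₀) (fromℤ-* (A k 1F) z₁))) (fromℤ-* (A k 2F) z₂))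

  clear-denominators : ∀ {d m n} → 0# < d → ∀ x →
    d * ⟨ x , 1# - m / d - n / d ∷ m / d ∷ n / d ∷ [] ⟩ ≈ ⟨ x , d - m - n ∷ m ∷ n ∷ [] ⟩
  clear-denominators {d} {m} {n} 0<d (x₀ ∷ x₁ ∷ x₂ ∷ []) = begin
    d * (X₀ * (1# - m / d - n / d) + X₁ * (m / d) + X₂ * (n / d))
      -- The solver treats `d ⁻¹` as a free variable `i`, so the factors are first regrouped into
      -- `d * d ⁻¹` and cancelled afterwards.
      ≈⟨ solve 7 (λ d m n i x₀ x₁ x₂ →
           d :* (x₀ :* (con 1ℤ :- m :* i :- n :* i) :+ x₁ :* (m :* i) :+ x₂ :* (n :* i)) :=
           x₀ :* (d :- m :* (d :* i) :- n :* (d :* i)) :+ x₁ :* (m :* (d :* i)) :+ x₂ :* (n :* (d :* i)))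
           ≈-refl d m n (d ⁻¹) X₀ X₁ X₂ ⟩
    X₀ * (d - m * (d * d ⁻¹) - n * (d * d ⁻¹)) + X₁ * (m * (d * d ⁻¹)) + X₂ * (n * (d * d ⁻¹))
      ≈⟨ +-cong (+-cong (*-congˡ (+-cong (+-congˡ (-‿cong (cancel m))) (-‿cong (cancel n))))
           (*-congˡ (cancel m))) (*-congˡ (cancel n)) ⟩
    X₀ * (d - m - n) + X₁ * m + X₂ * n ∎
    where
    X₀ X₁ X₂ : Carrier
    X₀ = fromℤ x₀
    X₁ = fromℤ x₁
    X₂ = fromℤ x₂
    cancel : ∀ k → k * (d * d ⁻¹) ≈ k
    cancel k = trans (*-congˡ (⁻¹-inverseʳ (0<⇒≉0 0<d))) (*-identityʳ k)

  -- The equation ν z = d · M (ν (T z)) in dual form, as L is the transpose of M.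
  ⟨ν⟩-Tmap : ∀ ij {x y} (h : InΔK x y) (h′ : InΔK (proj₁ (Tmap ij (x , y))) (proj₂ (Tmap ij (x , y)))) →
    let ((i , j) , _) = ij in
    ∃ λ d → 0# < d × (∀ z → ⟨ z , ν (_ , h) ⟩ ≈ d * ⟨ L i j · z , ν (_ , h′) ⟩)
  ⟨ν⟩-Tmap ij {x} {y} h _ = go ij
    where
    open InΔK h
    -- The denominators are sums of positive coordinates: `1 - x = γ + y` and `1 - y = γ + x`.
    0<1-x : 0# < 1# - x
    0<1-x = <-cong ≈-refl (solve 2 (λ x y → con 1ℤ :- x :- y :+ y := con 1ℤ :- x) ≈-refl x y) (0<+ 0<γ 0<β)
    0<1-y : 0# < 1# - y
    0<1-y = <-cong ≈-refl (solve 2 (λ x y → con 1ℤ :- x :- y :+ x := con 1ℤ :- y) ≈-refl x y) (0<+ 0<γ 0<α)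
    -- The polynomial identity left in each case once the image point is written as
    -- `(m / d , n / d)`.
    duality : ∀ {k} → Matrix → (d m n x y z₀ z₁ z₂ : Polynomial k) → Polynomial k × Polynomial k
    duality A d m n x y z₀ z₁ z₂ =
      z₀ :* (con 1ℤ :- x :- y) :+ z₁ :* x :+ z₂ :* y := form A z₀ z₁ z₂ (d :- m :- n) m n
    divide : ∀ A {d m n} → 0# < d →
      (∀ z → ⟨ z , 1# - x - y ∷ x ∷ y ∷ [] ⟩ ≈ expanded-form A z (d - m - n ∷ m ∷ n ∷ [])) →
      ∃ λ c → 0# < c ×
        (∀ z → ⟨ z , 1# - x - y ∷ x ∷ y ∷ [] ⟩ ≈ c * ⟨ A · z , 1# - m / d - n / d ∷ m / d ∷ n / d ∷ [] ⟩)
    divide A {d} {m} {n} 0<d eq = _ , 0<d , λ z →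
      trans (eq z) (trans (sym (⟨·⟩ A z (d - m - n ∷ m ∷ n ∷ []))) (sym (clear-denominators 0<d (A · z))))
    -- `ν` reads only the coordinates of a point, so the membership proof `h′` can be left out here.
    go : ∀ ij → let ((i , j) , _) = ij; (x′ , y′) = Tmap ij (x , y) in
      ∃ λ d → 0# < d ×
        (∀ z → ⟨ z , 1# - x - y ∷ x ∷ y ∷ [] ⟩ ≈ d * ⟨ L i j · z , 1# - x′ - y′ ∷ x′ ∷ y′ ∷ [] ⟩)
    go ((1F , 2F) , _) = divide (L 1F 2F) 0<1-y λ z → solve 5
      (λ x y → duality (L 1F 2F) (con 1ℤ :- y) (x :- y) y x y)
      ≈-refl x y (fromℤ (lookup z 0F)) (fromℤ (lookup z 1F)) (fromℤ (lookup z 2F))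
    go ((2F , 1F) , _) = divide (L 2F 1F) 0<1-x λ z → solve 5
      (λ x y → duality (L 2F 1F) (con 1ℤ :- x) x (y :- x) x y)
      ≈-refl x y (fromℤ (lookup z 0F)) (fromℤ (lookup z 1F)) (fromℤ (lookup z 2F))
    go ((0F , 1F) , _) = divide (L 0F 1F) 0<1-x λ z → solve 5
      (λ x y → duality (L 0F 1F) (con 1ℤ :- x) x y x y)
      ≈-refl x y (fromℤ (lookup z 0F)) (fromℤ (lookup z 1F)) (fromℤ (lookup z 2F))
    go ((1F , 0F) , _) = divide (L 1F 0F) (0<+ 0<α 0<β) λ z → solve 5
      (λ x y → duality (L 1F 0F) (x :+ y) (con (ℤ.+ 2) :* x :+ y :- con 1ℤ) y x y)
      ≈-refl x y (fromℤ (lookup z 0F)) (fromℤ (lookup z 1F)) (fromℤ (lookup z 2F))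
    go ((0F , 2F) , _) = divide (L 0F 2F) 0<1-y λ z → solve 5
      (λ x y → duality (L 0F 2F) (con 1ℤ :- y) x y x y)
      ≈-refl x y (fromℤ (lookup z 0F)) (fromℤ (lookup z 1F)) (fromℤ (lookup z 2F))
    go ((2F , 0F) , _) = divide (L 2F 0F) (0<+ 0<α 0<β) λ z → solve 5
      (λ x y → duality (L 2F 0F) (x :+ y) x (x :+ con (ℤ.+ 2) :* y :- con 1ℤ) x y)
      ≈-refl x y (fromℤ (lookup z 0F)) (fromℤ (lookup z 1F)) (fromℤ (lookup z 2F))
    go ((0F , 0F) , i≢i) = contradiction refl i≢i
    go ((1F , 1F) , i≢i) = contradiction refl i≢i
    go ((2F , 2F) , i≢i) = contradiction refl i≢i

  -- Signs of products.

  ≰0⇒0< : ∀ {x} → ¬ x ≤ 0# → 0# < x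
  ≰0⇒0< x≰0 = ≰⇒≥ x≰0 , λ 0≈x → x≰0 (≤-reflexive (sym 0≈x))

  0<⇒≰0 : ∀ {x} → 0# < x → ¬ x ≤ 0#
  0<⇒≰0 (0≤x , 0≉x) x≤0 = 0≉x (antisym 0≤x x≤0)

  *-nonpos : ∀ {x y} → 0# ≤ x → y ≤ 0# → x * y ≤ 0#
  *-nonpos {x} {y} 0≤x y≤0 = 0≤-⇒≤ (≤-respʳ-≈
    (solve 2 (λ x y → x :* (con 0ℤ :- y) := con 0ℤ :- x :* y) ≈-refl x y) (*-nonneg 0≤x (≤⇒0≤- y≤0)))

  *-cancel-0< : ∀ {x y} → 0# < x → 0# < x * y → 0# < y
  *-cancel-0< (0≤x , _) 0<xy = ≰0⇒0< λ y≤0 → 0<⇒≰0 0<xy (*-nonpos 0≤x y≤0)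

  *-cancel-≤0 : ∀ {x y} → 0# < x → x * y ≤ 0# → y ≤ 0#
  *-cancel-≤0 {x} {y} 0<x xy≤0 with y ≤? 0#
  ... | yes y≤0 = y≤0
  ... | no  y≰0 = contradiction xy≤0 (0<⇒≰0 (0<* 0<x (≰0⇒0< y≰0)))

  -- Comparison of the two stepped surfaces through `L`.

  module Dual (a a′ : Vec Carrier 3) (0<⟨e,a′⟩ : ∀ k → 0# < ⟨ e k , a′ ⟩)
              {i j : Fin 3} (i≢j : i ≢ j) {d : Carrier} (0<d : 0# < d)
              (scale : ∀ z → ⟨ z , a ⟩ ≈ d * ⟨ L i j · z , a′ ⟩) where

    height : Vec ℤ 3 → Carrier
    height x = ⟨ x , a′ ⟩

    -- Adding `e k` back increases the height by the positive coordinate of `a′` at `k`.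
    height-raise : ∀ x k → 0# < height (x ⊟ e k) → 0# < height x
    height-raise x k 0<x-e = <-cong ≈-refl
      (trans (+-congʳ (⟨⊟⟩ x (e k) a′)) (solve 2 (λ x y → x :- y :+ y := x) ≈-refl _ _))
      (0<+ 0<x-e (0<⟨e,a′⟩ k))

    height-lower : ∀ x k → height x ≤ 0# → height (x ⊟ e k) ≤ 0#
    height-lower x k x≤0 with height (x ⊟ e k) ≤? 0#
    ... | yes x-e≤0 = x-e≤0
    ... | no  x-e≰0 = contradiction x≤0 (0<⇒≰0 (height-raise x k (≰0⇒0< x-e≰0)))

    L·[z⊟eₖ] : ∀ z k → k ≢ i → L i j · (z ⊟ e k) ≡ L i j · z ⊟ e k
    L·[z⊟eₖ] z k k≢i =
      ≡.trans (·-distrib-⊟ (L i j) z (e k)) (cong (L i j · z ⊟_) (L·eₖ i j k k≢i))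

    L·[z⊟eᵢ] : ∀ z → L i j · (z ⊟ e i) ≡ L i j · z ⊟ e i ⊟ e j
    L·[z⊟eᵢ] z = ≡.trans (·-distrib-⊟ (L i j) z (e i))
      (≡.trans (cong (L i j · z ⊟_) (L·eᵢ i j i≢j)) (⊟-⊞ (L i j · z) (e i) (e j)))

    -- By `scale`, both conditions defining `𝒮 a` differ from conditions on heights only by the
    -- positive factor `d`. The variable `x` lets `L i j · (z ⊟ e k)` be supplied in rewritten form.
    𝒮⁺ : ∀ z k {x} → L i j · (z ⊟ e k) ≡ x → 0# < height (L i j · z) → height x ≤ 0# → 𝒮 a (z , k)
    𝒮⁺ z k refl 0<Lz x≤0 =
      <-cong ≈-refl (sym (scale z)) (0<* 0<d 0<Lz) ,
      ≤-respˡ-≈ (sym (scale (z ⊟ e k))) (*-nonpos (proj₁ 0<d) x≤0)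

    𝒮⁻ : ∀ z k {x} → L i j · (z ⊟ e k) ≡ x → 𝒮 a (z , k) → 0# < height (L i j · z) × height x ≤ 0#
    𝒮⁻ z k refl (0<z , z-e≤0) =
      *-cancel-0< 0<d (<-cong ≈-refl (scale z) 0<z) ,
      *-cancel-≤0 0<d (≤-respˡ-≈ (scale (z ⊟ e k)) z-e≤0)

    -- For `k = i`, each candidate for `σ` gives one end of the required interval directly; the
    -- other end follows by raising along `e i` or lowering along `e j`.
    squares⊆𝒮 : ∀ σ {ρ} → 𝒮 a′ σ → ρ ∈ squares i≢j σ → 𝒮 a ρ
    squares⊆𝒮 σ {z , k} σ∈ ρ∈ = go (k Fin.≟ i) (∈-squares⁻ i≢j σ ρ∈)
      where
      go : Dec (k ≡ i) → σ ≡ (L i j · z , k) ⊎ (k ≡ i × σ ≡ (L i j · z ⊟ e i , j)) → 𝒮 a (z , k)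
      go _ (inj₂ (k≡i , σ≡)) = subst (λ k → 𝒮 a (z , k)) (≡.sym k≡i)
        (𝒮⁺ z i (L·[z⊟eᵢ] z) (height-raise (L i j · z) i (proj₁ τ∈)) (proj₂ τ∈))
        where τ∈ = subst (𝒮 a′) σ≡ σ∈
      go (no k≢i) (inj₁ σ≡) = 𝒮⁺ z k (L·[z⊟eₖ] z k k≢i) (proj₁ τ∈) (proj₂ τ∈)
        where τ∈ = subst (𝒮 a′) σ≡ σ∈
      go (yes k≡i) (inj₁ σ≡) = subst (λ k → 𝒮 a (z , k)) (≡.sym k≡i)
        (𝒮⁺ z i (L·[z⊟eᵢ] z) (proj₁ τ∈) (height-lower (L i j · z ⊟ e i) j (proj₂ τ∈)))
        where τ∈ = subst (𝒮 a′) (≡.trans σ≡ (cong (L i j · z ,_) k≡i)) σ∈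

    -- The two candidates (L z, i*) and (L z − eᵢ, j*) for containing (z, i*)
    -- lie on opposite sides of height (L z − eᵢ) = 0.
    candidates-exclusive : ∀ σ τ z k → 𝒮 a′ σ → 𝒮 a′ τ → k ≡ i →
      σ ≡ (L i j · z , k) → τ ≢ (L i j · z ⊟ e i , j)
    candidates-exclusive σ τ z k σ∈ τ∈ k≡i σ≡ τ≡ = 0<⇒≰0
      (proj₁ (subst (𝒮 a′) τ≡ τ∈))
      (proj₂ (subst (𝒮 a′) (≡.trans σ≡ (cong (L i j · z ,_) k≡i)) σ∈))

    -- A common square leaves two candidates for `σ` and `τ`. Choosing the same one forces `σ ≡ τ`,
    -- and choosing different ones is a sign contradiction.
    squares-disjoint : ∀ σ τ {ρ} → 𝒮 a′ σ → 𝒮 a′ τ → σ ≢ τ →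
                       ρ ∈ squares i≢j σ → ρ ∉ squares i≢j τ
    squares-disjoint σ τ {z , k} σ∈ τ∈ σ≢τ ρ∈σ ρ∈τ =
      go (∈-squares⁻ i≢j σ ρ∈σ) (∈-squares⁻ i≢j τ ρ∈τ)
      where
      Candidate : UnitSquare → Set
      Candidate σ = σ ≡ (L i j · z , k) ⊎ (k ≡ i × σ ≡ (L i j · z ⊟ e i , j))
      go : Candidate σ → Candidate τ → ⊥
      go (inj₁ σ≡)         (inj₁ τ≡)         = σ≢τ (≡.trans σ≡ (≡.sym τ≡))
      go (inj₂ (_ , σ≡))   (inj₂ (_ , τ≡))   = σ≢τ (≡.trans σ≡ (≡.sym τ≡))
      go (inj₁ σ≡)         (inj₂ (k≡i , τ≡)) = candidates-exclusive σ τ z k σ∈ τ∈ k≡i σ≡ τ≡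
      go (inj₂ (k≡i , σ≡)) (inj₁ τ≡)         = candidates-exclusive τ σ z k τ∈ σ∈ k≡i τ≡ σ≡

    squares-cover : ∀ ρ → 𝒮 a ρ → ∃ λ σ → 𝒮 a′ σ × ρ ∈ squares i≢j σ
    squares-cover (z , k) ρ∈ = go (k Fin.≟ i) (height (L i j · z ⊟ e i) ≤? 0#)
      where
      go : Dec (k ≡ i) → Dec (height (L i j · z ⊟ e i) ≤ 0#) →
           ∃ λ σ → 𝒮 a′ σ × (z , k) ∈ squares i≢j σ
      -- Here `L` fixes `e k`, so `𝒮⁻` is already membership of `(L z , k)` in `𝒮 a′`.
      go (no k≢i)   _        = (L i j · z , k) , 𝒮⁻ z k (L·[z⊟eₖ] z k k≢i) ρ∈ , ∈-squares⁺ˡ i≢j z k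
      -- For `k = i` the sign of the height of `L z - eᵢ` selects the preimage and supplies one of
      -- its two bounds; `ρ∈` supplies the other.
      go (yes refl) (yes ≤0) = (L i j · z , i) , (proj₁ (𝒮⁻ z i refl ρ∈) , ≤0) , ∈-squares⁺ˡ i≢j z i
      go (yes refl) (no ≰0)  =
        (L i j · z ⊟ e i , j) , (≰0⇒0< ≰0 , proj₂ (𝒮⁻ z i (L·[z⊟eᵢ] z) ρ∈)) , ∈-squares⁺ʳ i≢j z

  -- From lists of squares back to formal sums.

  Tiles : Ind → (a a′ : Vec Carrier 3) → Set
  Tiles ij a a′ =
    ((σ : UnitSquare) → 𝒮 a′ σ →
      ((ρ : UnitSquare) → ρ occursIn Θ ij ⟪ σ ⟫ → 𝒮 a ρ) × 𝒢 a (Θ ij ⟪ σ ⟫))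
    ×
    ((σ τ : UnitSquare) → 𝒮 a′ σ → 𝒮 a′ τ → σ ≢ τ →
      (ρ : UnitSquare) → ¬ (ρ occursIn Θ ij ⟪ σ ⟫ × ρ occursIn Θ ij ⟪ τ ⟫))
    ×
    ((ρ : UnitSquare) → 𝒮 a ρ →
      ∃ λ σ → 𝒮 a′ σ × Θ ij ⟪ σ ⟫ ≻ ⟪ ρ ⟫)

  Dual⇒Tiles : (a a′ : Vec Carrier 3) → (∀ k → 0# < ⟨ e k , a′ ⟩) →
    (ij : Ind) → let ((i , j) , _) = ij in
    (∃ λ d → 0# < d × (∀ z → ⟨ z , a ⟩ ≈ d * ⟨ L i j · z , a′ ⟩)) → Tiles ij a a′
  Dual⇒Tiles a a′ 0<⟨e,a′⟩ ((i , j) , i≢j) (d , 0<d , scale) =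
    -- The image is its own witness for `𝒢`, since each of its entries already lies in `𝒮 a`.
    (λ σ σ∈ → (λ ρ ρ∈ → squares⊆𝒮 σ σ∈ (occurs⇒∈ σ ρ∈)) , Θ ((i , j) , i≢j) ⟪ σ ⟫ ,
      subst (All (λ cρ → 𝒮 a (proj₂ cρ))) (≡.sym (Θ-squares i≢j σ))
        (All.map⁺ (All.tabulate (λ {ρ} → squares⊆𝒮 σ {ρ} σ∈))) ,
      λ _ → refl) ,
    (λ σ τ σ∈ τ∈ σ≢τ ρ (ρ∈σ , ρ∈τ) →
      squares-disjoint σ τ σ∈ τ∈ σ≢τ (occurs⇒∈ σ ρ∈σ) (occurs⇒∈ τ ρ∈τ)) ,
    λ ρ ρ∈ → let (σ , σ∈ , ρ∈σ) = squares-cover ρ ρ∈ in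
      σ , σ∈ , subst (_≻ ⟪ ρ ⟫) (≡.sym (Θ-squares i≢j σ)) (≻⟪⟫ (squares-unique i≢j σ) ρ∈σ)
    where
    open Dual a a′ 0<⟨e,a′⟩ i≢j 0<d scale
    occurs⇒∈ : ∀ σ {ρ} → ρ occursIn Θ ((i , j) , i≢j) ⟪ σ ⟫ → ρ ∈ squares i≢j σ
    occurs⇒∈ σ {ρ} = occursIn⇒∈ (squares i≢j σ) ∘ subst (ρ occursIn_) (Θ-squares i≢j σ)

  -- Fixing `w′` only through its coordinates keeps the choice of `ij` and the proof that the image
  -- lies in `ΔK` abstract.
  Tmap-Tiles : (ij : Ind) (w w′ : ΔK) → proj₁ w′ ≡ Tmap ij (proj₁ w) → Tiles ij (ν w) (ν w′)
  Tmap-Tiles ij ((x , y) , h) (_ , h′) refl =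
    Dual⇒Tiles (ν ((x , y) , h)) (ν (Tmap ij (x , y) , h′))
      (λ k → 0<⟨e,ν⟩ k (Tmap ij (x , y) , h′)) ij (⟨ν⟩-Tmap ij h h′)

-- Iterates of `T`.

≗fold⇒suc : ∀ {A : Set} (f : A → A) (g : ℕ → A) z → (∀ n → g n ≡ fold z f n) → ∀ n → g (suc n) ≡ f (g n)
-- `fold z f (suc n)` is `f (fold z f n)` by definition; with `f` and `g` abstract, this is checked
-- without computing any iterate.
≗fold⇒suc f g z g≗fold n = ≡.trans (g≗fold (suc n)) (cong f (≡.sym (g≗fold n)))

-- Only unapplied modules are opened from here on: an applied one introduces copies
-- of its names, and comparing a copy with the original unfolds T and ε, which is
-- prohibitively slow.  For the same reason T^-suc is not proved by refl.
module Iteration {𝓡 : RealNumbers} (K : RealCubicField 𝓡) (p q : ℕ) .{{_ : NonZero q}} where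
  open CubicPoints using (ΔK)
  open Algorithm using (ε; T; T^)
  open SteppedSurface using (ν)
  open Descent using (Tiles; Tmap-Tiles)

  T-Tiles : (w w′ : ΔK K) → w′ ≡ T K p q w → Tiles K (ε K p q w) (ν K w) (ν K w′)
  T-Tiles w w′ w′≡Tw = Tmap-Tiles K (ε K p q w) w w′ (cong proj₁ w′≡Tw)

  T^≡fold : ∀ n z → T^ K p q n z ≡ fold z (T K p q) n
  T^≡fold n z = refl

  T^-suc : ∀ n z → T^ K p q (suc n) z ≡ T K p q (T^ K p q n z)
  T^-suc n z = ≗fold⇒suc (T K p q) (λ n → T^ K p q n z) z (λ n → T^≡fold n z) n

  T^-Tiles : ∀ n z → Tiles K (ε K p q (T^ K p q n z)) (ν K (T^ K p q n z)) (ν K (T^ K p q (suc n) z))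
  T^-Tiles n z = T-Tiles (T^ K p q n z) (T^ K p q (suc n) z) (T^-suc n z)

theorem5p5 :
  (𝓡 : RealNumbers) (K : RealCubicField 𝓡)
  (p q : ℕ) .{{_ : NonZero p}} .{{_ : NonZero q}} → Coprime p q → ¬ (3 ∣ p) →
  (z : CubicPoints.ΔK K) (n : ℕ) →
  let εₙ  = Algorithm.ε K p q (Algorithm.T^ K p q n z)
      aₙ  = SteppedSurface.ν K (Algorithm.T^ K p q n z)
      aₙ₊₁ = SteppedSurface.ν K (Algorithm.T^ K p q (suc n) z)
  in
  ((σ : UnitSquare) → SteppedSurface.𝒮 K aₙ₊₁ σ →
    ((ρ : UnitSquare) → ρ occursIn Θ εₙ ⟪ σ ⟫ → SteppedSurface.𝒮 K aₙ ρ) × SteppedSurface.𝒢 K aₙ (Θ εₙ ⟪ σ ⟫))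
  ×
  ((σ τ : UnitSquare) → SteppedSurface.𝒮 K aₙ₊₁ σ → SteppedSurface.𝒮 K aₙ₊₁ τ → σ ≢ τ →
    (ρ : UnitSquare) → ¬ (ρ occursIn Θ εₙ ⟪ σ ⟫ × ρ occursIn Θ εₙ ⟪ τ ⟫))
  ×
  ((ρ : UnitSquare) → SteppedSurface.𝒮 K aₙ ρ →
    ∃ λ σ → SteppedSurface.𝒮 K aₙ₊₁ σ × Θ εₙ ⟪ σ ⟫ ≻ ⟪ ρ ⟫)
theorem5p5 𝓡 K p q _ _ z n = Iteration.T^-Tiles K p q n z
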